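{- Let $(\alpha,\beta,\gamma)\in\{(1,2,3),(1,2,5),(1,2,7),(1,3,4),(1,3,5)\}$. For all integers $k\ge 1$ and $n\ge k(3k+1)/2$, we have ${\rm TP}_{\alpha,\beta,\gamma}^{k}(n)\ge 0$, with strict inequality except for the following cases, in which the value is $0$: \begin{align*} &{\rm TP}_{1,2,3}^{1}(n)=0\ \text{ for } n=13;\\ &{\rm TP}_{1,2,5}^{1}(n)=0\ \text{ for } n=11,13,15;\\ &{\rm TP}_{1,2,7}^{1}(n)=0\ \text{ for } n=7,9,11,13,14,15;\\ &{\rm TP}_{1,3,4}^{1}(n)=0\ \text{ for } n=11,13,14,17,38,41;\\ &{\rm TP}_{1,3,5}^{1}(n)=0\ \text{ for } n=10,11,13,14,16,37. \end{align*} In particular, ${\rm TP}_{\alpha,\beta,\gamma}^{k}(n)>0$ for all integers $k>1$ and $n\ge k(3k+1)/2$.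
   Context: For distinct pairwise coprime integers $\alpha,\beta,\gamma\ge 1$ and an integer $k\ge 1$, the integers ${\rm TP}_{\alpha,\beta,\gamma}^{k}(n)$ ($n\ge 0$) are defined by the formal power series identity $$\sum_{n\ge 0}{\rm TP}_{\alpha,\beta,\gamma}^{k}(n)q^n=\frac{(-1)^k}{(1-q^\alpha)(1-q^\beta)(1-q^\gamma)}\sum_{j\ge k}(-1)^jq^{j(3j+1)/2}\left(1-q^{2j+1}\right).$$ -}

module Defs where

open import Data.Bool.Base using (if_then_else_)
open import Data.Fin.Base using (Fin; toℕ)
open import Data.Integer.Base using (ℤ; 0ℤ; 1ℤ; -1ℤ; _+_; _-_; _*_; _^_; -_)
import Data.Integer.Properties as ℤ
open import Data.List.Base using (List; []; _∷_)
open import Data.List.Membership.Propositional using (_∈_)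
open import Data.Nat.Base as ℕ using (ℕ; zero; suc; _∸_; _/_; NonZero; z≤n; s≤s)
open import Data.Nat.Divisibility using (_∣_; _∣?_; ∣⇒≤; ∣m∸n∣n⇒∣m; ∣m+n∣m⇒∣n; ∣-refl; _∣0)
open import Data.Nat.DivMod using (/-monoˡ-≤; m*n/n≡m)
import Data.Nat.Properties as ℕ
open import Data.Product.Base using (_×_; _,_)
open import Relation.Binary.PropositionalEquality
open import Relation.Nullary.Decidable using (Dec; does; yes; no; dec-true; dec-false)

open import Algebra.Properties.Semiring.Sum ℤ.+-*-semiring using (*-distribˡ-sum)
open import Algebra.Properties.CommutativeMonoid.Sum ℤ.+-0-commutativeMonoid
  using (sum; sum⁺-syntax; sum-cong-≗; sum-replicate-zero; ∑-distrib-+)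

-- Formal power series in q with integer coefficients: n ↦ coefficient of qⁿ.
PowerSeries : Set
PowerSeries = ℕ → ℤ

infix  9 q^_
infixl 7 _⊛_
infixr 7 _·_
infixl 6 _⊖_

q^_ : ℕ → PowerSeries
(q^ m) n = if does (m ℕ.≟ n) then 1ℤ else 0ℤ

one : PowerSeries
one = q^ 0

_⊖_ : PowerSeries → PowerSeries → PowerSeries
(f ⊖ g) n = f n - g n

_·_ : ℤ → PowerSeries → PowerSeries
(c · f) n = c * f n

_⊛_ : PowerSeries → PowerSeries → PowerSeries
(f ⊛ g) n = ∑[ i ≤ n ] (f (toℕ i) * g (n ∸ toℕ i))

-- The geometric series 1 + q^a + q^2a + ⋯; it is the inverse of 1 - q^a
-- whenever a ≥ 1, see 1-q^-inverse.
1/1-q^ : ℕ → PowerSeries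
1/1-q^ a n = if does (a ∣? n) then 1ℤ else 0ℤ

-- The infinite sum F 0 + F 1 + F 2 + ⋯. Truncating at index n in the
-- coefficient of qⁿ is correct only if F j has no terms of degree below j.
-- The family used in TP satisfies this, see term-order.
∑∞ : (ℕ → PowerSeries) → PowerSeries
∑∞ F n = ∑[ j ≤ n ] F (toℕ j) n

term : ℕ → PowerSeries
term j = -1ℤ ^ j · (q^ (j ℕ.* (3 ℕ.* j ℕ.+ 1) / 2) ⊛ (one ⊖ q^ (2 ℕ.* j ℕ.+ 1)))

-- The sum over j ≥ k is reindexed as j = k + i with i ≥ 0.
TP : (α β γ k : ℕ) → PowerSeries
TP α β γ k =
  -1ℤ ^ k · (1/1-q^ α ⊛ (1/1-q^ β ⊛ (1/1-q^ γ ⊛ ∑∞ (λ i → term (k ℕ.+ i)))))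

triples : List (ℕ × ℕ × ℕ)
triples = (1 , 2 , 3) ∷ (1 , 2 , 5) ∷ (1 , 2 , 7) ∷ (1 , 3 , 4) ∷ (1 , 3 , 5) ∷ []

data Exceptional : (α β γ k n : ℕ) → Set where
  exc-1,2,3 : ∀ {n} → n ∈ 13 ∷ []                              → Exceptional 1 2 3 1 n
  exc-1,2,5 : ∀ {n} → n ∈ 11 ∷ 13 ∷ 15 ∷ []                    → Exceptional 1 2 5 1 n
  exc-1,2,7 : ∀ {n} → n ∈ 7 ∷ 9 ∷ 11 ∷ 13 ∷ 14 ∷ 15 ∷ []       → Exceptional 1 2 7 1 n
  exc-1,3,4 : ∀ {n} → n ∈ 11 ∷ 13 ∷ 14 ∷ 17 ∷ 38 ∷ 41 ∷ []     → Exceptional 1 3 4 1 n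
  exc-1,3,5 : ∀ {n} → n ∈ 10 ∷ 11 ∷ 13 ∷ 14 ∷ 16 ∷ 37 ∷ []     → Exceptional 1 3 5 1 n

q^-⊛-≤ : ∀ m n f → m ℕ.≤ n → (q^ m ⊛ f) n ≡ f (n ∸ m)
q^-⊛-≤ zero n f _ = begin
  1ℤ * f n + sum (λ i → 0ℤ * f (n ∸ suc (toℕ {n} i)))
    ≡⟨ cong₂ _+_ (ℤ.*-identityˡ (f n))
         (trans (sum-cong-≗ {n} (λ i → ℤ.*-zeroˡ (f (n ∸ suc (toℕ i))))) (sum-replicate-zero n)) ⟩
  f n + 0ℤ
    ≡⟨ ℤ.+-identityʳ (f n) ⟩
  f n ∎
  where open ≡-Reasoning
q^-⊛-≤ (suc m) (suc n) f (s≤s m≤n) =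
  trans (cong₂ _+_ (ℤ.*-zeroˡ (f (suc n))) (q^-⊛-≤ m n f m≤n)) (ℤ.+-identityˡ _)

q^-⊛-> : ∀ m n f → n ℕ.< m → (q^ m ⊛ f) n ≡ 0ℤ
q^-⊛-> (suc m) zero    f _         = trans (ℤ.+-identityʳ _) (ℤ.*-zeroˡ (f 0))
q^-⊛-> (suc m) (suc n) f (s≤s n<m) =
  trans (cong₂ _+_ (ℤ.*-zeroˡ (f (suc n))) (q^-⊛-> m n f n<m)) refl

⊖-⊛ : ∀ f g h n → ((f ⊖ g) ⊛ h) n ≡ (f ⊛ h) n - (g ⊛ h) n
⊖-⊛ f g h n = begin
  ((f ⊖ g) ⊛ h) n                   ≡⟨ sum-cong-≗ {suc n} pointwise ⟩
  ∑[ i ≤ n ] (u i + -1ℤ * v i)      ≡⟨ ∑-distrib-+ {suc n} u (λ i → -1ℤ * v i) ⟩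
  sum u + ∑[ i ≤ n ] (-1ℤ * v i)    ≡⟨ cong (sum u +_) (*-distribˡ-sum {suc n} -1ℤ v) ⟨
  sum u + -1ℤ * sum v               ≡⟨ cong (sum u +_) (ℤ.-1*i≡-i (sum v)) ⟩
  (f ⊛ h) n - (g ⊛ h) n             ∎
  where
  open ≡-Reasoning
  u v : Fin (suc n) → ℤ
  u i = f (toℕ i) * h (n ∸ toℕ i)
  v i = g (toℕ i) * h (n ∸ toℕ i)
  pointwise : ∀ i → (f ⊖ g) (toℕ i) * h (n ∸ toℕ i) ≡ u i + -1ℤ * v i
  pointwise i = begin
    (x - y) * z          ≡⟨ ℤ.*-distribʳ-+ z x (- y) ⟩
    x * z + - y * z      ≡⟨ cong (x * z +_) (ℤ.neg-distribˡ-* y z) ⟨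
    x * z + - (y * z)    ≡⟨ cong (x * z +_) (ℤ.-1*i≡-i (y * z)) ⟨
    x * z + -1ℤ * (y * z) ∎
    where
    x = f (toℕ i)
    y = g (toℕ i)
    z = h (n ∸ toℕ i)

1-q^-inverse : ∀ a .{{_ : NonZero a}} → (one ⊖ q^ a) ⊛ 1/1-q^ a ≗ one
1-q^-inverse a n = begin
  ((one ⊖ q^ a) ⊛ G) n       ≡⟨ ⊖-⊛ one (q^ a) G n ⟩
  (one ⊛ G) n - (q^ a ⊛ G) n ≡⟨ cong (λ x → x - (q^ a ⊛ G) n) (q^-⊛-≤ 0 n G z≤n) ⟩
  G n - (q^ a ⊛ G) n         ≡⟨ lemma n (a ℕ.≤? n) ⟩
  one n                      ∎
  where
  open ≡-Reasoning
  G = 1/1-q^ a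
  one≡0 : ∀ {m} → 0 ℕ.< m → one m ≡ 0ℤ
  one≡0 (s≤s _) = refl
  lemma : ∀ n → Dec (a ℕ.≤ n) → G n - (q^ a ⊛ G) n ≡ one n
  lemma n (yes a≤n) = begin
    G n - (q^ a ⊛ G) n    ≡⟨ cong (λ x → G n - x) (q^-⊛-≤ a n G a≤n) ⟩
    G n - G (n ∸ a)       ≡⟨ cong (λ x → x - G (n ∸ a)) (periodic (a ∣? n)) ⟩
    G (n ∸ a) - G (n ∸ a) ≡⟨ ℤ.+-inverseʳ (G (n ∸ a)) ⟩
    0ℤ                    ≡⟨ one≡0 (ℕ.<-≤-trans (ℕ.>-nonZero⁻¹ a) a≤n) ⟨
    one n                 ∎
    where
    periodic : Dec (a ∣ n) → G n ≡ G (n ∸ a)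
    periodic (yes a∣n) = cong (if_then 1ℤ else 0ℤ) (trans (dec-true (a ∣? n) a∣n)
      (sym (dec-true (a ∣? (n ∸ a)) (∣m+n∣m⇒∣n (subst (a ∣_) (sym (ℕ.m+[n∸m]≡n a≤n)) a∣n) ∣-refl))))
    periodic (no a∤n) = cong (if_then 1ℤ else 0ℤ) (trans (dec-false (a ∣? n) a∤n)
      (sym (dec-false (a ∣? (n ∸ a)) (λ a∣n∸a → a∤n (∣m∸n∣n⇒∣m a a≤n a∣n∸a ∣-refl)))))
  lemma zero (no a≰0) = begin
    G 0 - (q^ a ⊛ G) 0 ≡⟨ cong (λ x → G 0 - x) (q^-⊛-> a 0 G (ℕ.≰⇒> a≰0)) ⟩
    G 0 - 0ℤ           ≡⟨ cong (λ b → (if b then 1ℤ else 0ℤ) - 0ℤ) (dec-true (a ∣? 0) (a ∣0)) ⟩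
    1ℤ                 ∎
  lemma (suc n) (no a≰n) = begin
    G (suc n) - (q^ a ⊛ G) (suc n) ≡⟨ cong (λ x → G (suc n) - x) (q^-⊛-> a (suc n) G (ℕ.≰⇒> a≰n)) ⟩
    G (suc n) - 0ℤ                 ≡⟨ cong (λ b → (if b then 1ℤ else 0ℤ) - 0ℤ)
                                        (dec-false (a ∣? suc n) (λ a∣n → a≰n (∣⇒≤ a∣n))) ⟩
    0ℤ                             ∎

term-order : ∀ j n → n ℕ.< j → term j n ≡ 0ℤ
term-order (suc j) n n<j =
  trans (cong (-1ℤ ^ suc j *_) (q^-⊛-> (suc j ℕ.* (3 ℕ.* suc j ℕ.+ 1) / 2) n (one ⊖ q^ (2 ℕ.* suc j ℕ.+ 1)) (ℕ.<-≤-trans n<j bound))) (ℤ.*-zeroʳ (-1ℤ ^ suc j))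
  where
  open ℕ.≤-Reasoning
  bound : suc j ℕ.≤ suc j ℕ.* (3 ℕ.* suc j ℕ.+ 1) / 2
  bound = begin
    suc j                                   ≡⟨ m*n/n≡m (suc j) 2 ⟨
    suc j ℕ.* 2 / 2                         ≤⟨ /-monoˡ-≤ 2 (ℕ.*-monoʳ-≤ (suc j)
                                                 (ℕ.+-monoˡ-≤ 1 (ℕ.*-mono-≤ {1} {3} (s≤s z≤n) (s≤s {0} {j} z≤n)))) ⟩
    suc j ℕ.* (3 ℕ.* suc j ℕ.+ 1) / 2       ∎

{-# OPTIONS --safe #-}

-- Let P n be the coefficients of 1/((1-q)(1-q^b)(1-q^c)), and t k m the value of TP^k at
-- n = k(3k+1)/2 + m. Splitting off the first term of the alternating sum gives
--   t k m = P m - P (m - 2k - 1) - t (k+1) (m - 3k - 2),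
-- where P and t vanish at negative arguments. P is quasi-polynomial: with M = 2bc, the
-- difference M P n - n² - (1+b+c)n is periodic. Hence M t k m + M t (k+1) (m - 3k - 2) equals,
-- up to a bounded error, a polynomial which is itself G k m + G (k+1) (m - 3k - 2) for
-- G k m = k(2m + k + b + c + 3). Downward induction on k, starting from the last J with
-- J(3J+1)/2 ≤ n, gives |M t k m - G k m| ≤ 2J² + O(J), while G k m is about 3kJ² when J is
-- large compared to k. So t is positive outside a finite region, which is evaluated; for
-- k = J the sum has a single term and is positive directly.

module Submission where

open import Defs
open import Data.Integer.Base using (0ℤ) renaming (_≤_ to _≤ℤ_; _<_ to _<ℤ_)
open import Data.List.Membership.Propositional using (_∈_)
open import Data.Nat.Base using (ℕ; _+_; _*_; _/_; _≤_; _<_)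
open import Data.Product.Base using (_×_; _,_)
open import Relation.Binary.PropositionalEquality using (_≡_)
open import Relation.Nullary.Negation using (¬_)

open import Data.Bool.Base using (if_then_else_)
open import Data.Fin.Base using (toℕ)
import Data.Integer.Base as ℤ
open import Data.Integer.Base using (ℤ; 1ℤ; -1ℤ; +≤+; +<+)
  renaming (_+_ to _+ℤ_; _-_ to _-ℤ_; _*_ to _*ℤ_; _^_ to _^ℤ_)
import Data.Integer.Properties as ℤ
open import Data.Integer.Solver using (module +-*-Solver)
open import Data.Integer.Tactic.RingSolver using (solve-∀)
open import Data.List.Base using (List; []; _∷_)
import Data.List.Membership.DecPropositional as DecMembership
open import Data.List.Relation.Unary.All as All using (All)
open import Data.List.Relation.Unary.Any using (here; there)
open import Data.Nat.Base using (zero; suc; _∸_; _%_; NonZero; >-nonZero⁻¹; z≤n; s≤s; s≤s⁻¹)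
open import Data.Nat.Divisibility using (_∣?_; ∣m∣n⇒∣m+n; ∣m+n∣m⇒∣n; ∣-refl; ∣⇒≤; _∣0; n∣m*n)
open import Data.Nat.DivMod
  using (m≡m%n+[m/n]*n; m%n<n; [m+kn]%n≡m%n; m*n/n≡m; +-distrib-/-∣ʳ)
import Data.Nat.Properties as ℕ
import Data.Nat.Tactic.RingSolver as ℕ
open import Data.Product.Base using (∃₂)
open import Data.Sum.Base using (_⊎_; inj₁; inj₂; [_,_]′)
open import Data.Unit.Base using (tt)
open import Function.Base using (_∘_)
open import Relation.Binary.PropositionalEquality
  using (_≗_; refl; sym; trans; cong; cong₂; subst; subst₂; module ≡-Reasoning)
open import Relation.Nullary.Decidable
  using (Dec; does; yes; no; dec-true; dec-false; toWitness; _⊎-dec_)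
open import Relation.Nullary.Negation using (contradiction)

open import Algebra.Properties.CommutativeMonoid.Sum ℤ.+-0-commutativeMonoid
  using (sum-syntax; sum⁺-syntax; sum-cong-≗; sum-replicate-zero; ∑-distrib-+)
open import Algebra.Properties.Semiring.Sum ℤ.+-*-semiring using (*-distribˡ-sum)

open DecMembership ℕ._≟_ using (_∈?_)

-- Linearity of convolution, and commutation with monomials.

Vanishes-below : ℕ → PowerSeries → Set
Vanishes-below N f = ∀ n → n < N → f n ≡ 0ℤ

⊛-congʳ : ∀ h {f g} → f ≗ g → h ⊛ f ≗ h ⊛ g
⊛-congʳ h f≗g n = sum-cong-≗ {suc n} (λ i → cong (h (toℕ i) *ℤ_) (f≗g (n ∸ toℕ i)))

⊛-congˡ : ∀ {h k} f → h ≗ k → h ⊛ f ≗ k ⊛ f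
⊛-congˡ f h≗k n = sum-cong-≗ {suc n} (λ i → cong (_*ℤ f (n ∸ toℕ i)) (h≗k (toℕ i)))

⊛-vanishes-below : ∀ h {f} N → Vanishes-below N f → Vanishes-below N (h ⊛ f)
⊛-vanishes-below h N f≡0 n n<N = trans
  (sum-cong-≗ {suc n} λ i → trans
    (cong (h (toℕ i) *ℤ_) (f≡0 (n ∸ toℕ i) (ℕ.≤-<-trans (ℕ.m∸n≤m n (toℕ i)) n<N)))
    (ℤ.*-zeroʳ (h (toℕ i))))
  (sum-replicate-zero (suc n))

⊛-distribˡ-⊖ : ∀ h f g → h ⊛ (f ⊖ g) ≗ (h ⊛ f) ⊖ (h ⊛ g)
⊛-distribˡ-⊖ h f g n = begin
  (h ⊛ (f ⊖ g)) n
    ≡⟨ sum-cong-≗ {suc n} (λ i → pointwise (h (toℕ i)) (f (n ∸ toℕ i)) (g (n ∸ toℕ i))) ⟩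
  ∑[ i ≤ n ] (u (toℕ i) +ℤ -1ℤ *ℤ v (toℕ i))
    ≡⟨ ∑-distrib-+ {suc n} (u ∘ toℕ) (λ i → -1ℤ *ℤ v (toℕ i)) ⟩
  (h ⊛ f) n +ℤ ∑[ i ≤ n ] (-1ℤ *ℤ v (toℕ i))
    ≡⟨ cong ((h ⊛ f) n +ℤ_) (*-distribˡ-sum {suc n} -1ℤ (v ∘ toℕ)) ⟨
  (h ⊛ f) n +ℤ -1ℤ *ℤ (h ⊛ g) n              ≡⟨ cong ((h ⊛ f) n +ℤ_) (ℤ.-1*i≡-i ((h ⊛ g) n)) ⟩
  ((h ⊛ f) ⊖ (h ⊛ g)) n                  ∎
  where
  open ≡-Reasoning
  u v : ℕ → ℤ
  u i = h i *ℤ f (n ∸ i)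
  v i = h i *ℤ g (n ∸ i)
  pointwise : ∀ x y z → x *ℤ (y -ℤ z) ≡ x *ℤ y +ℤ -1ℤ *ℤ (x *ℤ z)
  pointwise = solve-∀

⊛-·-comm : ∀ h c f → h ⊛ (c · f) ≗ c · (h ⊛ f)
⊛-·-comm h c f n = trans
  (sum-cong-≗ {suc n} (λ i → pointwise (h (toℕ i)) c (f (n ∸ toℕ i))))
  (sym (*-distribˡ-sum {suc n} c (λ i → h (toℕ i) *ℤ f (n ∸ toℕ i))))
  where
  pointwise : ∀ x y z → x *ℤ (y *ℤ z) ≡ y *ℤ (x *ℤ z)
  pointwise = solve-∀

q^-⊛-shift : ∀ m n f → (q^ m ⊛ f) (m + n) ≡ f n
q^-⊛-shift m n f = trans (q^-⊛-≤ m (m + n) f (ℕ.m≤m+n m n)) (cong f (ℕ.m+n∸m≡n m n))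

q^suc-⊛ : ∀ m n f → (q^ suc m ⊛ f) (suc n) ≡ (q^ m ⊛ f) n
q^suc-⊛ m n f = trans (cong (_+ℤ (q^ m ⊛ f) n) (ℤ.*-zeroˡ (f (suc n)))) (ℤ.+-identityˡ _)

-- The sum behind `⊛` unfolds at its left factor, so `lemma` peels coefficients off `h`; this is why
-- `h` varies in the induction and becomes `h ∘ suc`.
⊛-q-comm : ∀ h f → h ⊛ (q^ 1 ⊛ f) ≗ q^ 1 ⊛ (h ⊛ f)
⊛-q-comm h f zero    = ⊛-vanishes-below h 1 (λ n → q^-⊛-> 1 n f) 0 ℕ.0<1+n
⊛-q-comm h f (suc n) = trans (lemma n h) (sym (q^-⊛-shift 1 n (h ⊛ f)))
  where
  lemma : ∀ n h → (h ⊛ (q^ 1 ⊛ f)) (suc n) ≡ (h ⊛ f) n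
  lemma zero    h = cong₂ _+ℤ_ (cong (h 0 *ℤ_) (q^-⊛-shift 1 0 f))
    (cong (_+ℤ 0ℤ) (trans (cong (h 1 *ℤ_) (q^-⊛-> 1 0 f ℕ.0<1+n)) (ℤ.*-zeroʳ (h 1))))
  lemma (suc n) h = cong₂ _+ℤ_ (cong (h 0 *ℤ_) (q^-⊛-shift 1 (suc n) f)) (lemma n (h ∘ suc))

q^suc-⊛-split : ∀ m f → q^ suc m ⊛ f ≗ q^ 1 ⊛ (q^ m ⊛ f)
q^suc-⊛-split m f zero    = trans (q^-⊛-> (suc m) 0 f ℕ.0<1+n) (sym (q^-⊛-> 1 0 (q^ m ⊛ f) ℕ.0<1+n))
q^suc-⊛-split m f (suc n) = trans (q^suc-⊛ m n f) (sym (q^-⊛-shift 1 n (q^ m ⊛ f)))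

-- Together with linearity, this does the work of commutativity and associativity of `⊛`: the only
-- factors ever moved are scalars and monomials.
⊛-q^-comm : ∀ h m f → h ⊛ (q^ m ⊛ f) ≗ q^ m ⊛ (h ⊛ f)
⊛-q^-comm h zero    f n = trans (⊛-congʳ h (λ i → q^-⊛-shift 0 i f) n) (sym (q^-⊛-shift 0 n (h ⊛ f)))
⊛-q^-comm h (suc m) f n = begin
  (h ⊛ (q^ suc m ⊛ f)) n         ≡⟨ ⊛-congʳ h (q^suc-⊛-split m f) n ⟩
  (h ⊛ (q^ 1 ⊛ (q^ m ⊛ f))) n    ≡⟨ ⊛-q-comm h (q^ m ⊛ f) n ⟩
  (q^ 1 ⊛ (h ⊛ (q^ m ⊛ f))) n    ≡⟨ ⊛-congʳ (q^ 1) (⊛-q^-comm h m f) n ⟩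
  (q^ 1 ⊛ (q^ m ⊛ (h ⊛ f))) n    ≡⟨ q^suc-⊛-split m (h ⊛ f) n ⟨
  (q^ suc m ⊛ (h ⊛ f)) n         ∎
  where open ≡-Reasoning

q^-⊛-one : ∀ m → q^ m ⊛ one ≗ q^ m
q^-⊛-one zero    zero    = refl
q^-⊛-one zero    (suc n) = q^-⊛-shift 0 (suc n) one
q^-⊛-one (suc m) zero    = q^-⊛-> (suc m) 0 one ℕ.0<1+n
q^-⊛-one (suc m) (suc n) = trans (q^suc-⊛ m n one) (q^-⊛-one m n)

⊛-drop-zeros : ∀ m h f n → Vanishes-below m h → (h ⊛ f) (m + n) ≡ ((λ i → h (m + i)) ⊛ f) n
⊛-drop-zeros zero    h f n _   = refl
⊛-drop-zeros (suc m) h f n h≡0 = begin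
  h 0 *ℤ f (suc m + n) +ℤ ((h ∘ suc) ⊛ f) (m + n)
    ≡⟨ cong (λ x → x *ℤ f (suc m + n) +ℤ ((h ∘ suc) ⊛ f) (m + n)) (h≡0 0 ℕ.0<1+n) ⟩
  0ℤ *ℤ f (suc m + n) +ℤ ((h ∘ suc) ⊛ f) (m + n)
    ≡⟨ cong₂ _+ℤ_ (ℤ.*-zeroˡ (f (suc m + n))) (⊛-drop-zeros m (h ∘ suc) f n (λ i i<m → h≡0 (suc i) (s≤s i<m))) ⟩
  0ℤ +ℤ ((λ i → h (suc m + i)) ⊛ f) n               ≡⟨ ℤ.+-identityˡ _ ⟩
  ((λ i → h (suc m + i)) ⊛ f) n                      ∎
  where open ≡-Reasoning

-- The geometric series as a recurrence.

1/1-q^-periodic : ∀ a n → 1/1-q^ a (a + n) ≡ 1/1-q^ a n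
1/1-q^-periodic a n with a ∣? n
... | yes a∣n = cong (if_then 1ℤ else 0ℤ) (dec-true (a ∣? (a + n)) (∣m∣n⇒∣m+n ∣-refl a∣n))
... | no  a∤n = cong (if_then 1ℤ else 0ℤ) (dec-false (a ∣? (a + n)) (λ a∣a+n → a∤n (∣m+n∣m⇒∣n a∣a+n ∣-refl)))

-- The coefficients of the geometric series are 1, then a - 1 zeros, then the whole series again by
-- periodicity. So the convolution is its first summand plus the same convolution at a degree lower
-- by `a`.
1/1-q^-⊛-step : ∀ a .{{_ : NonZero a}} f n →
  (1/1-q^ a ⊛ f) (a + n) ≡ f (a + n) +ℤ (1/1-q^ a ⊛ f) n
1/1-q^-⊛-step (suc a) f n = cong₂ _+ℤ_ head (trans
  (⊛-drop-zeros a (1/1-q^ (suc a) ∘ suc) f n (λ i i<a → cong (if_then 1ℤ else 0ℤ)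
    (dec-false (suc a ∣? suc i) (λ a∣i → ℕ.<⇒≱ (s≤s i<a) (∣⇒≤ a∣i)))))
  (⊛-congˡ f (1/1-q^-periodic (suc a)) n))
  where
  head : 1/1-q^ (suc a) 0 *ℤ f (suc a + n) ≡ f (suc a + n)
  head = trans (cong (λ b → (if b then 1ℤ else 0ℤ) *ℤ f (suc a + n)) (dec-true (suc a ∣? 0) (suc a ∣0)))
    (ℤ.*-identityˡ _)

-- Pentagonal exponents and tails of the alternating sum.

pent : ℕ → ℕ
pent k = k * (3 * k + 1) / 2

pent-suc : ∀ k → pent (suc k) ≡ pent k + (3 * k + 2)
pent-suc k = begin
  suc k * (3 * suc k + 1) / 2                     ≡⟨ cong (_/ 2) (expand k) ⟩
  -- The increment (3k + 2) · 2 is even, so the rounding division by 2 splits.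
  (k * (3 * k + 1) + (3 * k + 2) * 2) / 2
    ≡⟨ +-distrib-/-∣ʳ (k * (3 * k + 1)) (n∣m*n (3 * k + 2)) ⟩
  pent k + (3 * k + 2) * 2 / 2                    ≡⟨ cong (pent k +_) (m*n/n≡m (3 * k + 2) 2) ⟩
  pent k + (3 * k + 2)                            ∎
  where
  open ≡-Reasoning
  expand : ∀ k → suc k * (3 * suc k + 1) ≡ k * (3 * k + 1) + (3 * k + 2) * 2
  expand = ℕ.solve-∀

pent-mono : ∀ k i → pent k ≤ pent (k + i)
pent-mono k zero    = ℕ.≤-reflexive (cong pent (sym (ℕ.+-identityʳ k)))
pent-mono k (suc i) = ℕ.≤-trans (pent-mono k i) (ℕ.≤-trans
  (ℕ.≤-trans (ℕ.m≤m+n (pent (k + i)) _) (ℕ.≤-reflexive (sym (pent-suc (k + i)))))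
  (ℕ.≤-reflexive (cong pent (sym (ℕ.+-suc k i)))))

term-vanishes-below : ∀ k → Vanishes-below (pent k) (term k)
term-vanishes-below k n n<g =
  trans (cong (-1ℤ ^ℤ k *ℤ_) (q^-⊛-> (pent k) n (one ⊖ q^ (2 * k + 1)) n<g)) (ℤ.*-zeroʳ (-1ℤ ^ℤ k))

tail : ℕ → PowerSeries
tail k = ∑∞ (λ i → term (k + i))

tail-vanishes-below : ∀ k → Vanishes-below (pent k) (tail k)
tail-vanishes-below k n n<g = trans
  (sum-cong-≗ {suc n} λ i → term-vanishes-below (k + toℕ i) n (ℕ.<-≤-trans n<g (pent-mono k (toℕ i))))
  (sum-replicate-zero (suc n))

sum-snoc : ∀ n (f : ℕ → ℤ) → ∑[ i ≤ n ] f (toℕ i) ≡ ∑[ i < n ] f (toℕ i) +ℤ f n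
sum-snoc zero    f = ℤ.+-comm (f 0) 0ℤ
sum-snoc (suc n) f = trans (cong (f 0 +ℤ_) (sum-snoc n (f ∘ suc))) (sym (ℤ.+-assoc (f 0) _ (f (suc n))))

-- Both tails are truncated after n + 1 terms, so the left one reaches one index further, to k + 1 +
-- n. That last term has no coefficient at degree n by `term-order`.
tail-suc : ∀ k → tail (suc k) ≗ tail k ⊖ term k
tail-suc k n = begin
  tail (suc k) n                                         ≡⟨ sum-snoc n (λ i → term (suc k + i) n) ⟩
  ∑[ i < n ] term (suc k + toℕ i) n +ℤ term (suc k + n) n
    ≡⟨ cong (S +ℤ_) (term-order (suc k + n) n (s≤s (ℕ.m≤n+m n k))) ⟩
  S +ℤ 0ℤ                                                ≡⟨ rearrange S (term k n) ⟩
  term k n +ℤ S -ℤ term k n                              ≡⟨ cong (_-ℤ term k n) tail-k ⟨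
  tail k n -ℤ term k n                                   ∎
  where
  open ≡-Reasoning
  S = ∑[ i < n ] term (suc k + toℕ i) n
  rearrange : ∀ x y → x +ℤ 0ℤ ≡ y +ℤ x -ℤ y
  rearrange = solve-∀
  tail-k : tail k n ≡ term k n +ℤ S
  tail-k = cong₂ _+ℤ_ (cong (λ j → term j n) (ℕ.+-identityʳ k))
    (sum-cong-≗ {n} (λ i → cong (λ j → term j n) (ℕ.+-suc k (toℕ i))))

-1^k*-1^k≡1 : ∀ k → -1ℤ ^ℤ k *ℤ -1ℤ ^ℤ k ≡ 1ℤ
-1^k*-1^k≡1 zero    = refl
-1^k*-1^k≡1 (suc k) = trans (square (-1ℤ ^ℤ k)) (-1^k*-1^k≡1 k)
  where
  square : ∀ x → -1ℤ *ℤ x *ℤ (-1ℤ *ℤ x) ≡ x *ℤ x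
  square = solve-∀

-- The recurrence of `TP` in k.

module _ (α β γ : ℕ) where

  over : PowerSeries → PowerSeries
  over f = 1/1-q^ α ⊛ (1/1-q^ β ⊛ (1/1-q^ γ ⊛ f))

  over-cong : ∀ {f g} → f ≗ g → over f ≗ over g
  over-cong f≗g = ⊛-congʳ (1/1-q^ α) (⊛-congʳ (1/1-q^ β) (⊛-congʳ (1/1-q^ γ) f≗g))

  over-vanishes-below : ∀ {f} N → Vanishes-below N f → Vanishes-below N (over f)
  over-vanishes-below N f≡0 = ⊛-vanishes-below (1/1-q^ α) N
    (⊛-vanishes-below (1/1-q^ β) N (⊛-vanishes-below (1/1-q^ γ) N f≡0))

  over-distrib-⊖ : ∀ f g → over (f ⊖ g) ≗ over f ⊖ over g
  over-distrib-⊖ f g n = begin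
    over (f ⊖ g) n
      ≡⟨ ⊛-congʳ a (⊛-congʳ b (⊛-distribˡ-⊖ c f g)) n ⟩
    (a ⊛ (b ⊛ (c ⊛ f ⊖ c ⊛ g))) n
      ≡⟨ ⊛-congʳ a (⊛-distribˡ-⊖ b (c ⊛ f) (c ⊛ g)) n ⟩
    (a ⊛ (b ⊛ (c ⊛ f) ⊖ b ⊛ (c ⊛ g))) n
      ≡⟨ ⊛-distribˡ-⊖ a (b ⊛ (c ⊛ f)) (b ⊛ (c ⊛ g)) n ⟩
    (over f ⊖ over g) n ∎
    where
    open ≡-Reasoning
    a = 1/1-q^ α
    b = 1/1-q^ β
    c = 1/1-q^ γ

  over-·-comm : ∀ x f → over (x · f) ≗ x · over f
  over-·-comm x f n = begin
    over (x · f) n                 ≡⟨ ⊛-congʳ a (⊛-congʳ b (⊛-·-comm c x f)) n ⟩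
    (a ⊛ (b ⊛ (x · (c ⊛ f)))) n    ≡⟨ ⊛-congʳ a (⊛-·-comm b x (c ⊛ f)) n ⟩
    (a ⊛ (x · (b ⊛ (c ⊛ f)))) n    ≡⟨ ⊛-·-comm a x (b ⊛ (c ⊛ f)) n ⟩
    (x · over f) n                 ∎
    where
    open ≡-Reasoning
    a = 1/1-q^ α
    b = 1/1-q^ β
    c = 1/1-q^ γ

  over-q^-comm : ∀ m f → over (q^ m ⊛ f) ≗ q^ m ⊛ over f
  over-q^-comm m f n = begin
    over (q^ m ⊛ f) n                 ≡⟨ ⊛-congʳ a (⊛-congʳ b (⊛-q^-comm c m f)) n ⟩
    (a ⊛ (b ⊛ (q^ m ⊛ (c ⊛ f)))) n    ≡⟨ ⊛-congʳ a (⊛-q^-comm b m (c ⊛ f)) n ⟩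
    (a ⊛ (q^ m ⊛ (b ⊛ (c ⊛ f)))) n    ≡⟨ ⊛-q^-comm a m (b ⊛ (c ⊛ f)) n ⟩
    (q^ m ⊛ over f) n                 ∎
    where
    open ≡-Reasoning
    a = 1/1-q^ α
    b = 1/1-q^ β
    c = 1/1-q^ γ

  -- The sign and the monomial of exponent `pent k` pass through `over`; reading off the coefficient
  -- at `pent k + m` then undoes the shift.
  over-term : ∀ k m → over (term k) (pent k + m) ≡
    -1ℤ ^ℤ k *ℤ (over one m -ℤ (q^ (2 * k + 1) ⊛ over one) m)
  over-term k m = begin
    over (term k) (pent k + m)                          ≡⟨ over-·-comm s (q^ pent k ⊛ D) (pent k + m) ⟩
    s *ℤ over (q^ pent k ⊛ D) (pent k + m)
      ≡⟨ cong (s *ℤ_) (over-q^-comm (pent k) D (pent k + m)) ⟩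
    s *ℤ (q^ pent k ⊛ over D) (pent k + m)
      ≡⟨ cong (s *ℤ_) (q^-⊛-shift (pent k) m (over D)) ⟩
    s *ℤ over D m
      ≡⟨ cong (s *ℤ_) (over-distrib-⊖ one (q^ (2 * k + 1)) m) ⟩
    s *ℤ (over one m -ℤ over (q^ (2 * k + 1)) m)        ≡⟨ cong (λ x → s *ℤ (over one m -ℤ x)) shifted ⟩
    s *ℤ (over one m -ℤ (q^ (2 * k + 1) ⊛ over one) m)  ∎
    where
    open ≡-Reasoning
    s = -1ℤ ^ℤ k
    D = one ⊖ q^ (2 * k + 1)
    shifted : over (q^ (2 * k + 1)) m ≡ (q^ (2 * k + 1) ⊛ over one) m
    shifted = trans (over-cong (λ n → sym (q^-⊛-one (2 * k + 1) n)) m) (over-q^-comm (2 * k + 1) one m)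

  -- With H from the tail, V from its first term and s the sign, `TP` is sH at k and -s(H - V) at k
  -- + 1, by `tail-suc`. Since s² = 1, `over-term` identifies sV with the difference of the two
  -- coefficients of `over one`.
  TP-recurrence : ∀ k m → TP α β γ k (pent k + m) ≡
    over one m -ℤ (q^ (2 * k + 1) ⊛ over one) m -ℤ TP α β γ (suc k) (pent k + m)
  TP-recurrence k m = begin
    s *ℤ H                                            ≡⟨ rearrange (s *ℤ H) (s *ℤ V) ⟩
    s *ℤ V -ℤ -1ℤ *ℤ (s *ℤ H -ℤ s *ℤ V)               ≡⟨ cong₂ (λ x y → x -ℤ y) s*V≡D TP-suc ⟨
    D -ℤ TP α β γ (suc k) (pent k + m)                ∎
    where
    open ≡-Reasoning
    s = -1ℤ ^ℤ k
    H = over (tail k) (pent k + m)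
    V = over (term k) (pent k + m)
    D = over one m -ℤ (q^ (2 * k + 1) ⊛ over one) m
    rearrange : ∀ x y → x ≡ y -ℤ -1ℤ *ℤ (x -ℤ y)
    rearrange = solve-∀
    distrib : ∀ x y z → -1ℤ *ℤ x *ℤ (y -ℤ z) ≡ -1ℤ *ℤ (x *ℤ y -ℤ x *ℤ z)
    distrib = solve-∀
    s*V≡D : D ≡ s *ℤ V
    s*V≡D = begin
      D               ≡⟨ ℤ.*-identityˡ D ⟨
      1ℤ *ℤ D         ≡⟨ cong (_*ℤ D) (-1^k*-1^k≡1 k) ⟨
      s *ℤ s *ℤ D     ≡⟨ ℤ.*-assoc s s D ⟩
      s *ℤ (s *ℤ D)   ≡⟨ cong (s *ℤ_) (over-term k m) ⟨
      s *ℤ V          ∎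
    TP-suc : TP α β γ (suc k) (pent k + m) ≡ -1ℤ *ℤ (s *ℤ H -ℤ s *ℤ V)
    TP-suc = begin
      -1ℤ *ℤ s *ℤ over (tail (suc k)) (pent k + m)
        ≡⟨ cong (-1ℤ *ℤ s *ℤ_) (over-cong (tail-suc k) (pent k + m)) ⟩
      -1ℤ *ℤ s *ℤ over (tail k ⊖ term k) (pent k + m)
        ≡⟨ cong (-1ℤ *ℤ s *ℤ_) (over-distrib-⊖ (tail k) (term k) (pent k + m)) ⟩
      -1ℤ *ℤ s *ℤ (H -ℤ V)
        ≡⟨ distrib s H V ⟩
      -1ℤ *ℤ (s *ℤ H -ℤ s *ℤ V) ∎

  TP-vanishes-below : ∀ k → Vanishes-below (pent k) (TP α β γ k)
  TP-vanishes-below k n n<g = trans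
    (cong (-1ℤ ^ℤ k *ℤ_) (over-vanishes-below (pent k) (tail-vanishes-below k) n n<g))
    (ℤ.*-zeroʳ (-1ℤ ^ℤ k))

-- Tools for periodic sequences and shifted coefficients.

period-induction : ∀ {Q : ℕ → Set} L .{{_ : NonZero L}} →
  (∀ {n} → n < L → Q n) → (∀ n → Q n → Q (L + n)) → ∀ n → Q n
period-induction {Q} L base step n = subst Q (sym n≡q*L+r) (iterate (n / L))
  where
  iterate : ∀ q → Q (q * L + n % L)
  iterate zero    = base (m%n<n n L)
  iterate (suc q) = subst Q (sym (ℕ.+-assoc L (q * L) (n % L))) (step (q * L + n % L) (iterate q))
  n≡q*L+r : n ≡ n / L * L + n % L
  n≡q*L+r = trans (m≡m%n+[m/n]*n n L) (ℕ.+-comm (n % L) (n / L * L))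

-- hits c b i n counts the multiples of c among n + b, n + 2b, …, n + ib.
hits : (c b : ℕ) → ℕ → PowerSeries
hits c b zero    n = 0ℤ
hits c b (suc i) n = hits c b i n +ℤ (1/1-q^ c ⊛ one) (b + (i * b + n))

-- Multiplication by the monomial of exponent e, done by one comparison and one lookup instead of a
-- convolution; this keeps `eval` cheap.
drop : ℕ → (ℕ → ℤ) → ℕ → ℤ
drop e f m = if does (m ℕ.<? e) then 0ℤ else f (m ∸ e)

drop-elim : ∀ e f m {x} → (m < e → x ≡ 0ℤ) → (e ≤ m → x ≡ f (m ∸ e)) → x ≡ drop e f m
drop-elim e f m {x} x≡0 x≡f = go (m ℕ.<? e)
  where
  go : (m<e? : Dec (m < e)) → x ≡ (if does m<e? then 0ℤ else f (m ∸ e))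
  go (yes m<e) = x≡0 m<e
  go (no m≮e)  = x≡f (ℕ.≮⇒≥ m≮e)

numerator : (b c hi : ℕ) → ℕ → ℕ
numerator b c hi n = n * n + (1 + b + c) * n + hi

Nonnegative-except : (α β γ : ℕ) → Set
Nonnegative-except α β γ =
  (∀ k n → 1 ≤ k → k * (3 * k + 1) / 2 ≤ n →
    (0ℤ ≤ℤ TP α β γ k n)
    × (¬ Exceptional α β γ k n → 0ℤ <ℤ TP α β γ k n)
    × (Exceptional α β γ k n → TP α β γ k n ≡ 0ℤ))
  × (∀ k n → 1 < k → k * (3 * k + 1) / 2 ≤ n → 0ℤ <ℤ TP α β γ k n)

-- Integer inequalities and offsets.

0≤pos : ∀ {n} → 0ℤ ≤ℤ ℤ.+ n
0≤pos = +≤+ z≤n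

0≤+ : ∀ {i j} → 0ℤ ≤ℤ i → 0ℤ ≤ℤ j → 0ℤ ≤ℤ i +ℤ j
0≤+ = ℤ.+-mono-≤

0≤* : ∀ {i j} → 0ℤ ≤ℤ i → 0ℤ ≤ℤ j → 0ℤ ≤ℤ i *ℤ j
0≤* {i} {j} 0≤i 0≤j = subst (_≤ℤ i *ℤ j) (ℤ.*-zeroʳ i) (ℤ.*-monoˡ-≤-nonNeg i {{ℤ.nonNegative 0≤i}} 0≤j)

0≤square : ∀ i → 0ℤ ≤ℤ i *ℤ i
0≤square (ℤ.+ n)    = 0≤* {ℤ.+ n} {ℤ.+ n} 0≤pos 0≤pos
0≤square ℤ.-[1+ n ] = +≤+ z≤n

0≤difference : ∀ {m n} → m ≤ n → 0ℤ ≤ℤ ℤ.+ n -ℤ ℤ.+ m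
0≤difference m≤n = ℤ.i≤j⇒0≤j-i (+≤+ m≤n)

0<1+ : ∀ {i j} → i ≡ 1ℤ +ℤ j → 0ℤ ≤ℤ j → 0ℤ <ℤ i
0<1+ i≡1+j 0≤j = subst (0ℤ <ℤ_) (sym i≡1+j) (ℤ.+-mono-<-≤ (+<+ ℕ.0<1+n) 0≤j)

pos-linear : ∀ a k e r → ℤ.+ (a * k + e + r) ≡ ℤ.+ a *ℤ ℤ.+ k +ℤ ℤ.+ e +ℤ ℤ.+ r
pos-linear a k e r = begin
  ℤ.+ (a * k + e + r)                     ≡⟨ ℤ.pos-+ (a * k + e) r ⟩
  ℤ.+ (a * k + e) +ℤ ℤ.+ r                ≡⟨ cong (_+ℤ ℤ.+ r) (ℤ.pos-+ (a * k) e) ⟩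
  ℤ.+ (a * k) +ℤ ℤ.+ e +ℤ ℤ.+ r           ≡⟨ cong (λ x → x +ℤ ℤ.+ e +ℤ ℤ.+ r) (ℤ.pos-* a k) ⟩
  ℤ.+ a *ℤ ℤ.+ k +ℤ ℤ.+ e +ℤ ℤ.+ r        ∎
  where open ≡-Reasoning

-- The offset m with k(3k+1)/2 + m = J(3J+1)/2 + s, where J = k + d.
descend : ℕ → ℕ → ℕ → ℕ
descend zero    k s = s
descend (suc d) k s = 3 * k + 2 + descend d (suc k) s

-- Transporting along this equation keeps the type checker from unfolding TP when it compares
-- values at the two sides.
descend-suc : ∀ d k s → 3 * k + 2 + descend d (suc k) s ≡ descend (suc d) k s
descend-suc d k s = refl

-- For J = k + d, J(3J + 1) - k(3k + 1) = d(6k + 3d + 1). The equation is doubled to avoid halving.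
2*descend : ∀ d k s → 2 * descend d k s ≡ d * (6 * k + 3 * d + 1) + 2 * s
2*descend zero    k s = refl
2*descend (suc d) k s = begin
  2 * (3 * k + 2 + descend d (suc k) s)                        ≡⟨ ℕ.*-distribˡ-+ 2 (3 * k + 2) _ ⟩
  2 * (3 * k + 2) + 2 * descend d (suc k) s
    ≡⟨ cong (2 * (3 * k + 2) +_) (2*descend d (suc k) s) ⟩
  2 * (3 * k + 2) + (d * (6 * suc k + 3 * d + 1) + 2 * s)      ≡⟨ rearrange d k s ⟩
  suc d * (6 * k + 3 * suc d + 1) + 2 * s                      ∎
  where
  open ≡-Reasoning
  rearrange : ∀ d k s → 2 * (3 * k + 2) + (d * (6 * suc k + 3 * d + 1) + 2 * s) ≡ suc d * (6 * k + 3 * suc d + 1) + 2 * s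
  rearrange = ℕ.solve-∀

-- Here σ = 1+b+c. The leading term is determined by
-- leading σ k m + leading σ (k+1) (m-3k-2) = n² + σn at n = m minus the same at n = m-2k-1.
leading : (σ k m : ℤ) → ℤ
leading σ k m = k *ℤ (ℤ.+ 2 *ℤ m +ℤ k +ℤ (σ +ℤ ℤ.+ 2))

-- 2J² + (σ+2)J + 35 + W(J-k) with J = k + d. The constant 35 is large enough for the starting
-- values of the induction for all five triples.
tolerance : (σ W d k : ℤ) → ℤ
tolerance σ W d k = ℤ.+ 2 *ℤ (k +ℤ d) *ℤ (k +ℤ d) +ℤ (σ +ℤ ℤ.+ 2) *ℤ (k +ℤ d) +ℤ ℤ.+ 35 +ℤ W *ℤ d

record Near (σ W d k m x : ℤ) : Set where
  constructor near
  field
    upper : 0ℤ ≤ℤ tolerance σ W d k -ℤ (x -ℤ leading σ k m)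
    lower : 0ℤ ≤ℤ tolerance σ W d k +ℤ (x -ℤ leading σ k m)

-- A lower bound, valid when σ + 2 + W ≤ 35, for the leading term minus the tolerance.
excess : (k d s : ℤ) → ℤ
excess k d s = ℤ.+ 6 *ℤ k *ℤ k *ℤ d +ℤ ℤ.+ 3 *ℤ k *ℤ d *ℤ d +ℤ ℤ.+ 2 *ℤ s *ℤ k
  -ℤ ℤ.+ 3 *ℤ k *ℤ d -ℤ k *ℤ k -ℤ ℤ.+ 2 *ℤ d *ℤ d -ℤ ℤ.+ 35 *ℤ (1ℤ +ℤ d)

quad : (σ hi n : ℤ) → ℤ
quad σ hi n = n *ℤ n +ℤ σ *ℤ n +ℤ hi

-- Polynomial inequalities behind the approximation.

open +-*-Solver

-- The superscript ᴾ marks syntactic copies for the ring solver.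
leadingᴾ : ∀ {n} (σ k m : Polynomial n) → Polynomial n
leadingᴾ σ k m = k :* (con (ℤ.+ 2) :* m :+ k :+ (σ :+ con (ℤ.+ 2)))

toleranceᴾ : ∀ {n} (σ W d k : Polynomial n) → Polynomial n
toleranceᴾ σ W d k = con (ℤ.+ 2) :* (k :+ d) :* (k :+ d) :+ (σ :+ con (ℤ.+ 2)) :* (k :+ d) :+ con (ℤ.+ 35) :+ W :* d

quadᴾ : ∀ {n} (σ hi x : Polynomial n) → Polynomial n
quadᴾ σ hi x = x :* x :+ σ :* x :+ hi

excessᴾ : ∀ {n} (k d s : Polynomial n) → Polynomial n
excessᴾ k d s = con (ℤ.+ 6) :* k :* k :* d :+ con (ℤ.+ 3) :* k :* d :* d :+ con (ℤ.+ 2) :* s :* k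
  :- con (ℤ.+ 3) :* k :* d :- k :* k :- con (ℤ.+ 2) :* d :* d :- con (ℤ.+ 35) :* (con 1ℤ :+ d)

hornerᴾ : ∀ {n} (c₀₀ c₀₁ c₀₂ c₁₀ c₂₀ c₁₁ c₂₁ c₁₂ : ℕ) (e f w : Polynomial n) → Polynomial n
hornerᴾ c₀₀ c₀₁ c₀₂ c₁₀ c₂₀ c₁₁ c₂₁ c₁₂ e f w =
  con (ℤ.+ c₀₀) :+ e :* (con (ℤ.+ c₀₁) :+ con (ℤ.+ c₀₂) :* e)
    :+ f :* (con (ℤ.+ c₁₀) :+ con (ℤ.+ c₂₀) :* f
      :+ e :* (con (ℤ.+ c₁₁) :+ con (ℤ.+ c₂₁) :* f :+ con (ℤ.+ c₁₂) :* e)) :+ w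

0≤by : ∀ {i j} → i ≡ j → 0ℤ ≤ℤ j → 0ℤ ≤ℤ i
0≤by i≡j = subst (0ℤ ≤ℤ_) (sym i≡j)

-- Starting values with s ≤ 2k, where only P s contributes. Each slack is rewritten as a sum of
-- visibly nonnegative terms: the upper one through 2k - s, the lower one through (s - k)².
low-near : ∀ {σ W hi k s δ} → 0ℤ ≤ℤ σ → 0ℤ ≤ℤ hi → 0ℤ ≤ℤ k → 0ℤ ≤ℤ s → 0ℤ ≤ℤ δ →
  0ℤ ≤ℤ ℤ.+ 2 *ℤ k -ℤ s → 0ℤ ≤ℤ ℤ.+ 35 -ℤ hi → 0ℤ ≤ℤ ℤ.+ 35 -ℤ δ →
  Near σ W 0ℤ k s (quad σ hi s -ℤ δ)
low-near {σ} {W} {hi} {k} {s} {δ} 0≤σ 0≤hi 0≤k 0≤s 0≤δ s≤2k hi≤35 δ≤35 = near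
  (0≤by (solve 6 (λ σ W hi k s δ →
      toleranceᴾ σ W (con 0ℤ) k :- (quadᴾ σ hi s :- δ :- leadingᴾ σ k s) :=
      s :* (con (ℤ.+ 2) :* k :- s) :+ (σ :+ con (ℤ.+ 2)) :* (con (ℤ.+ 2) :* k :- s)
        :+ con (ℤ.+ 2) :* s :+ con (ℤ.+ 3) :* k :* k :+ (con (ℤ.+ 35) :- hi) :+ δ) refl σ W hi k s δ)
    (0≤+ (0≤+ (0≤+ (0≤+ (0≤+ (0≤* 0≤s s≤2k) (0≤* (0≤+ 0≤σ (0≤pos {2})) s≤2k)) (0≤* (0≤pos {2}) 0≤s))
      (0≤* (0≤* (0≤pos {3}) 0≤k) 0≤k)) hi≤35) 0≤δ))
  (0≤by (solve 6 (λ σ W hi k s δ →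
      toleranceᴾ σ W (con 0ℤ) k :+ (quadᴾ σ hi s :- δ :- leadingᴾ σ k s) :=
      (s :- k) :* (s :- k) :+ σ :* s :+ hi :+ (con (ℤ.+ 35) :- δ)) refl σ W hi k s δ)
    (0≤+ (0≤+ (0≤+ (0≤square (s -ℤ k)) (0≤* 0≤σ 0≤s)) 0≤hi) δ≤35))

-- Starting values with 2k < s ≤ 3k + 1, where P r is subtracted as well. The constant 35 absorbs σ
-- + 2 + W in the upper bound and δ in the lower one.
mid-near : ∀ {σ W hi k r δ δ′} → let s = ℤ.+ 2 *ℤ k +ℤ 1ℤ +ℤ r in
  0ℤ ≤ℤ σ → 0ℤ ≤ℤ k → 0ℤ ≤ℤ r → 0ℤ ≤ℤ δ → 0ℤ ≤ℤ δ′ →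
  0ℤ ≤ℤ k -ℤ r → 0ℤ ≤ℤ ℤ.+ 35 -ℤ (σ +ℤ ℤ.+ 2 +ℤ W) → 0ℤ ≤ℤ W -ℤ δ′ → 0ℤ ≤ℤ ℤ.+ 35 -ℤ δ →
  Near σ W 0ℤ k s (quad σ hi s -ℤ δ -ℤ (quad σ hi r -ℤ δ′))
mid-near {σ} {W} {hi} {k} {r} {δ} {δ′} 0≤σ 0≤k 0≤r 0≤δ 0≤δ′ r≤k σ+2+W≤35 δ′≤W δ≤35 = near
  (0≤by (solve 7 (λ σ W hi k r δ δ′ → let s = con (ℤ.+ 2) :* k :+ con 1ℤ :+ r in
      toleranceᴾ σ W (con 0ℤ) k :- (quadᴾ σ hi s :- δ :- (quadᴾ σ hi r :- δ′) :- leadingᴾ σ k s) :=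
      con (ℤ.+ 2) :* (k :- r) :* (k :+ con 1ℤ) :+ k :* k :+ con 1ℤ :+
        (con (ℤ.+ 35) :- (σ :+ con (ℤ.+ 2) :+ W)) :+ (W :- δ′) :+ δ) refl σ W hi k r δ δ′)
    (0≤+ (0≤+ (0≤+ (0≤+ (0≤+ (0≤* (0≤* (0≤pos {2}) r≤k) (0≤+ 0≤k (0≤pos {1}))) (0≤* 0≤k 0≤k))
      (0≤pos {1})) σ+2+W≤35) δ′≤W) 0≤δ))
  (0≤by (solve 7 (λ σ W hi k r δ δ′ → let s = con (ℤ.+ 2) :* k :+ con 1ℤ :+ r in
      toleranceᴾ σ W (con 0ℤ) k :+ (quadᴾ σ hi s :- δ :- (quadᴾ σ hi r :- δ′) :- leadingᴾ σ k s) :=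
      (k :- con 1ℤ) :* (k :- con 1ℤ) :+ con (ℤ.+ 2) :* (σ :+ con (ℤ.+ 2)) :* k :+ con (ℤ.+ 2) :* k :* r
        :+ con (ℤ.+ 2) :* r :+ σ :+ (con (ℤ.+ 35) :- δ) :+ δ′) refl σ W hi k r δ δ′)
    (0≤+ (0≤+ (0≤+ (0≤+ (0≤+ (0≤+ (0≤square (k -ℤ 1ℤ)) (0≤* (0≤* (0≤pos {2}) (0≤+ 0≤σ (0≤pos {2}))) 0≤k))
      (0≤* (0≤* (0≤pos {2}) 0≤k) 0≤r)) (0≤* (0≤pos {2}) 0≤r)) 0≤σ) δ≤35) 0≤δ′))

-- `leading` satisfies the recurrence exactly, so the deviation changes sign and picks up only δ′ -
-- δ, of size at most W. As k + d is unchanged, the tolerance grows by exactly W. Because of the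
-- sign change, the upper bound comes from the previous lower bound and conversely.
step-near : ∀ {σ W hi d k r δ δ′ y} → let m = ℤ.+ 3 *ℤ k +ℤ ℤ.+ 2 +ℤ r; n = 1ℤ +ℤ (k +ℤ r) in
  0ℤ ≤ℤ δ → 0ℤ ≤ℤ δ′ → 0ℤ ≤ℤ W -ℤ δ → 0ℤ ≤ℤ W -ℤ δ′ →
  Near σ W d (1ℤ +ℤ k) r y →
  Near σ W (1ℤ +ℤ d) k m (quad σ hi m -ℤ δ -ℤ (quad σ hi n -ℤ δ′) -ℤ y)
step-near {σ} {W} {hi} {d} {k} {r} {δ} {δ′} {y} 0≤δ 0≤δ′ δ≤W δ′≤W (near upper lower) = near
  (0≤by (solve 9 (λ σ W hi d k r δ δ′ y →
      let m = con (ℤ.+ 3) :* k :+ con (ℤ.+ 2) :+ r; n = con 1ℤ :+ (k :+ r); k′ = con 1ℤ :+ k in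
      toleranceᴾ σ W (con 1ℤ :+ d) k :- (quadᴾ σ hi m :- δ :- (quadᴾ σ hi n :- δ′) :- y :- leadingᴾ σ k m) :=
      toleranceᴾ σ W d k′ :+ (y :- leadingᴾ σ k′ r) :+ (W :- δ′) :+ δ) refl σ W hi d k r δ δ′ y)
    (0≤+ (0≤+ lower δ′≤W) 0≤δ))
  (0≤by (solve 9 (λ σ W hi d k r δ δ′ y →
      let m = con (ℤ.+ 3) :* k :+ con (ℤ.+ 2) :+ r; n = con 1ℤ :+ (k :+ r); k′ = con 1ℤ :+ k in
      toleranceᴾ σ W (con 1ℤ :+ d) k :+ (quadᴾ σ hi m :- δ :- (quadᴾ σ hi n :- δ′) :- y :- leadingᴾ σ k m) :=
      toleranceᴾ σ W d k′ :- (y :- leadingᴾ σ k′ r) :+ (W :- δ) :+ δ′) refl σ W hi d k r δ δ′ y)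
    (0≤+ (0≤+ upper δ≤W) 0≤δ′))

-- 1 + horner is the excess after substituting k = k₀ + f and d = d₀ + e.
horner : (c₀₀ c₀₁ c₀₂ c₁₀ c₂₀ c₁₁ c₂₁ c₁₂ : ℕ) (e f w : ℤ) → ℤ
horner c₀₀ c₀₁ c₀₂ c₁₀ c₂₀ c₁₁ c₂₁ c₁₂ e f w =
  ℤ.+ c₀₀ +ℤ e *ℤ (ℤ.+ c₀₁ +ℤ ℤ.+ c₀₂ *ℤ e)
    +ℤ f *ℤ (ℤ.+ c₁₀ +ℤ ℤ.+ c₂₀ *ℤ f +ℤ e *ℤ (ℤ.+ c₁₁ +ℤ ℤ.+ c₂₁ *ℤ f +ℤ ℤ.+ c₁₂ *ℤ e)) +ℤ w

0≤horner : ∀ c₀₀ c₀₁ c₀₂ c₁₀ c₂₀ c₁₁ c₂₁ c₁₂ {e f w} → 0ℤ ≤ℤ e → 0ℤ ≤ℤ f → 0ℤ ≤ℤ w →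
  0ℤ ≤ℤ horner c₀₀ c₀₁ c₀₂ c₁₀ c₂₀ c₁₁ c₂₁ c₁₂ e f w
0≤horner c₀₀ c₀₁ c₀₂ c₁₀ c₂₀ c₁₁ c₂₁ c₁₂ 0≤e 0≤f 0≤w =
  0≤+ (0≤+ (0≤+ (0≤pos {c₀₀}) (0≤* 0≤e (0≤+ (0≤pos {c₀₁}) (0≤* (0≤pos {c₀₂}) 0≤e))))
    (0≤* 0≤f (0≤+ (0≤+ (0≤pos {c₁₀}) (0≤* (0≤pos {c₂₀}) 0≤f))
      (0≤* 0≤e (0≤+ (0≤+ (0≤pos {c₁₁}) (0≤* (0≤pos {c₂₁}) 0≤f)) (0≤* (0≤pos {c₁₂}) 0≤e)))))) 0≤w

-- The lower bounds on d are those that make the excess positive for k ≥ 1, k ≥ 2 and k ≥ 4.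
data Large : ℕ → ℕ → Set where
  large₁ : ∀ f e → Large (1 + f) (34 + e)
  large₂ : ∀ f e → Large (2 + f) (6 + e)
  large₄ : ∀ f e → Large (4 + f) (1 + e)

-- Expanded around the thresholds, the excess has only nonnegative coefficients in e and f, with
-- constant term 32, 3 or 8; the literals are these coefficients, the constant term being lowered by
-- 1.
0<excess : ∀ {k d} → Large k d → ∀ s → 0ℤ <ℤ excess (ℤ.+ k) (ℤ.+ d) (ℤ.+ s)
0<excess (large₁ f e) s = 0<1+
  (solve 3 (λ e f s → excessᴾ (con (ℤ.+ 1) :+ f) (con (ℤ.+ 34) :+ e) s :=
    con 1ℤ :+ hornerᴾ 31 36 1 3772 203 213 6 3 e f (con (ℤ.+ 2) :* s :* (con (ℤ.+ 1) :+ f))) refl (ℤ.+ e) (ℤ.+ f) (ℤ.+ s))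
  (0≤horner 31 36 1 3772 203 213 6 3 (0≤pos {e}) (0≤pos {f}) (0≤* (0≤* (0≤pos {2}) (0≤pos {s})) (0≤pos {1 + f})))
0<excess (large₂ f e) s = 0<1+
  (solve 3 (λ e f s → excessᴾ (con (ℤ.+ 2) :+ f) (con (ℤ.+ 6) :+ e) s :=
    con 1ℤ :+ hornerᴾ 2 31 4 230 35 57 6 3 e f (con (ℤ.+ 2) :* s :* (con (ℤ.+ 2) :+ f))) refl (ℤ.+ e) (ℤ.+ f) (ℤ.+ s))
  (0≤horner 2 31 4 230 35 57 6 3 (0≤pos {e}) (0≤pos {f}) (0≤* (0≤* (0≤pos {2}) (0≤pos {s})) (0≤pos {2 + f})))
0<excess (large₄ f e) s = 0<1+
  (solve 3 (λ e f s → excessᴾ (con (ℤ.+ 4) :+ f) (con (ℤ.+ 1) :+ e) s :=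
    con 1ℤ :+ hornerᴾ 7 69 10 40 5 51 6 3 e f (con (ℤ.+ 2) :* s :* (con (ℤ.+ 4) :+ f))) refl (ℤ.+ e) (ℤ.+ f) (ℤ.+ s))
  (0≤horner 7 69 10 40 5 51 6 3 (0≤pos {e}) (0≤pos {f}) (0≤* (0≤* (0≤pos {2}) (0≤pos {s})) (0≤pos {4 + f})))

-- x is the excess plus two nonnegative slacks: (35 - σ - 2 - W)d, and the lower bound in `Near`.
0<main : ∀ {σ W} k d m s x →
  2 * m ≡ d * (6 * k + 3 * d + 1) + 2 * s →
  0ℤ ≤ℤ ℤ.+ 35 -ℤ (σ +ℤ ℤ.+ 2 +ℤ W) → 0ℤ <ℤ excess (ℤ.+ k) (ℤ.+ d) (ℤ.+ s) →
  Near σ W (ℤ.+ d) (ℤ.+ k) (ℤ.+ m) x → 0ℤ <ℤ x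
0<main {σ} {W} k d m s x 2m≡ σ+2+W≤35 0<excess (near _ lower) = subst (0ℤ <ℤ_) (sym x≡)
  (ℤ.+-mono-<-≤ 0<excess (0≤+ (0≤* σ+2+W≤35 (0≤pos {d})) lower))
  where
  open ≡-Reasoning
  K = ℤ.+ k
  D = ℤ.+ d
  S = ℤ.+ s
  u = ℤ.+ 2 *ℤ ℤ.+ m
  u≡ : u ≡ D *ℤ (ℤ.+ 6 *ℤ K +ℤ ℤ.+ 3 *ℤ D +ℤ 1ℤ) +ℤ ℤ.+ 2 *ℤ S
  u≡ = begin
    u                                                        ≡⟨ ℤ.pos-* 2 m ⟨
    ℤ.+ (2 * m)                                              ≡⟨ cong ℤ.+_ 2m≡ ⟩
    ℤ.+ (d * (6 * k + 3 * d + 1) + 2 * s)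
      ≡⟨ ℤ.pos-+ (d * (6 * k + 3 * d + 1)) (2 * s) ⟩
    ℤ.+ (d * (6 * k + 3 * d + 1)) +ℤ ℤ.+ (2 * s)
      ≡⟨ cong₂ _+ℤ_ (ℤ.pos-* d (6 * k + 3 * d + 1)) (ℤ.pos-* 2 s) ⟩
    D *ℤ ℤ.+ (6 * k + 3 * d + 1) +ℤ ℤ.+ 2 *ℤ S
      ≡⟨ cong (λ y → D *ℤ y +ℤ ℤ.+ 2 *ℤ S) (trans (pos-linear 6 k (3 * d) 1) (cong (λ y → ℤ.+ 6 *ℤ K +ℤ y +ℤ 1ℤ) (ℤ.pos-* 3 d))) ⟩
    D *ℤ (ℤ.+ 6 *ℤ K +ℤ ℤ.+ 3 *ℤ D +ℤ 1ℤ) +ℤ ℤ.+ 2 *ℤ S      ∎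
  leading≡ : leading σ K (ℤ.+ m) ≡ K *ℤ (D *ℤ (ℤ.+ 6 *ℤ K +ℤ ℤ.+ 3 *ℤ D +ℤ 1ℤ) +ℤ ℤ.+ 2 *ℤ S +ℤ K +ℤ (σ +ℤ ℤ.+ 2))
  leading≡ = cong (λ y → K *ℤ (y +ℤ K +ℤ (σ +ℤ ℤ.+ 2))) u≡
  x≡ : x ≡ excess K D S +ℤ ((ℤ.+ 35 -ℤ (σ +ℤ ℤ.+ 2 +ℤ W)) *ℤ D +ℤ (tolerance σ W D K +ℤ (x -ℤ leading σ K (ℤ.+ m))))
  x≡ = trans (solve 6 (λ σ W k d s x →
      x := excessᴾ k d s :+ ((con (ℤ.+ 35) :- (σ :+ con (ℤ.+ 2) :+ W)) :* d :+ (toleranceᴾ σ W d k :+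
        (x :- k :* (d :* (con (ℤ.+ 6) :* k :+ con (ℤ.+ 3) :* d :+ con 1ℤ) :+ con (ℤ.+ 2) :* s :+ k :+ (σ :+ con (ℤ.+ 2)))))))
      refl σ W K D S x)
    (cong (λ y → excess K D S +ℤ ((ℤ.+ 35 -ℤ (σ +ℤ ℤ.+ 2 +ℤ W)) *ℤ D +ℤ (tolerance σ W D K +ℤ (x -ℤ y)))) (sym leading≡))

-- The two quadratics differ by (2k + 1)(2k + 1 + 2r + σ), and (2k + 1)² ≥ 81 = 1 + 45 + 35
-- outweighs δ ≤ 35.
0<mid : ∀ {σ hi f r δ δ′} → let k = ℤ.+ 4 +ℤ f in
  0ℤ ≤ℤ σ → 0ℤ ≤ℤ f → 0ℤ ≤ℤ r → 0ℤ ≤ℤ δ′ → 0ℤ ≤ℤ ℤ.+ 35 -ℤ δ →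
  0ℤ <ℤ quad σ hi (ℤ.+ 2 *ℤ k +ℤ 1ℤ +ℤ r) -ℤ δ -ℤ (quad σ hi r -ℤ δ′)
0<mid {σ} {hi} {f} {r} {δ} {δ′} 0≤σ 0≤f 0≤r 0≤δ′ δ≤35 = 0<1+
  (solve 6 (λ σ hi f r δ δ′ → let k = con (ℤ.+ 4) :+ f in
    quadᴾ σ hi (con (ℤ.+ 2) :* k :+ con 1ℤ :+ r) :- δ :- (quadᴾ σ hi r :- δ′) :=
    con 1ℤ :+ ((con (ℤ.+ 9) :+ con (ℤ.+ 2) :* f) :* (con (ℤ.+ 2) :* r :+ σ) :+
      (con (ℤ.+ 45) :+ con (ℤ.+ 36) :* f :+ con (ℤ.+ 4) :* f :* f) :+ (con (ℤ.+ 35) :- δ) :+ δ′))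
    refl σ hi f r δ δ′)
  (0≤+ (0≤+ (0≤+ (0≤* (0≤+ (0≤pos {9}) (0≤* (0≤pos {2}) 0≤f)) (0≤+ (0≤* (0≤pos {2}) 0≤r) 0≤σ))
    (0≤+ (0≤+ (0≤pos {45}) (0≤* (0≤pos {36}) 0≤f)) (0≤* (0≤* (0≤pos {4}) 0≤f) 0≤f))) δ≤35) 0≤δ′)

*-distribˡ-−-via : ∀ w x y {z u v} → z ≡ x -ℤ y → w *ℤ x ≡ u → w *ℤ y ≡ v → w *ℤ z ≡ u -ℤ v
*-distribˡ-−-via w x y refl refl refl = distrib w x y
  where
  distrib : ∀ w x y → w *ℤ (x -ℤ y) ≡ w *ℤ x -ℤ w *ℤ y
  distrib = solve-∀

near-resp : ∀ {σ W d k m m′ x x′} → m ≡ m′ → x ≡ x′ → Near σ W d k m′ x′ → Near σ W d k m x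
near-resp refl refl n = n

-- Cutting an offset into blocks between pentagonal exponents.

descend-cover : ∀ fuel k m → m < fuel → ∃₂ λ d s → m ≡ descend d k s × s < 3 * (k + d) + 2
descend-cover (suc fuel) k m (s≤s m≤fuel) with m ℕ.<? 3 * k + 2
... | yes m<e = 0 , m , refl , subst (λ j → m < 3 * j + 2) (sym (ℕ.+-identityʳ k)) m<e
... | no  m≮e =
  let e≤m = ℕ.≮⇒≥ m≮e
      d , s , r≡ , s< = descend-cover fuel (suc k) (m ∸ (3 * k + 2))
        (ℕ.<-≤-trans (ℕ.∸-monoʳ-< (ℕ.<-≤-trans ℕ.0<1+n (ℕ.m≤n+m 2 (3 * k))) e≤m) m≤fuel)
  in suc d , s , trans (sym (ℕ.m+[n∸m]≡n e≤m)) (cong (3 * k + 2 +_) r≡)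
     , subst (λ j → s < 3 * j + 2) (sym (ℕ.+-suc k d)) s<

-- The first d₀ blocks are removed before `descend-cover` takes over, so d appears as d₀ + e, the
-- form the constructors of `Large` expect.
descend-split : ∀ d₀ k m → m < descend d₀ k 0 ⊎
  ∃₂ λ e s → m ≡ descend (d₀ + e) k s × s < 3 * (k + (d₀ + e)) + 2
descend-split zero     k m = inj₂ (descend-cover (suc m) k m ℕ.≤-refl)
descend-split (suc d₀) k m with m ℕ.<? 3 * k + 2
... | yes m<e = inj₁ (ℕ.<-≤-trans m<e (ℕ.m≤m+n (3 * k + 2) _))
... | no  m≮e with descend-split d₀ (suc k) (m ∸ (3 * k + 2))
...   | inj₁ r<                = inj₁ (subst (_< 3 * k + 2 + descend d₀ (suc k) 0) (ℕ.m+[n∸m]≡n (ℕ.≮⇒≥ m≮e)) (ℕ.+-monoʳ-< (3 * k + 2) r<))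
...   | inj₂ (e , s , r≡ , s<) = inj₂ (e , s
  , trans (sym (ℕ.m+[n∸m]≡n (ℕ.≮⇒≥ m≮e))) (cong (3 * k + 2 +_) r≡)
  , subst (λ j → s < 3 * j + 2) (sym (ℕ.+-suc k (d₀ + e))) s<)

-- Write 2bc P n = n² + (1+b+c)n + ρ n with ρ of period bc. Then hi is the maximum of ρ and
-- W the difference between its maximum and minimum; W < 2bc turns this into the closed form
-- P n = ⌊(n² + (1+b+c)n + hi) / 2bc⌋, whose remainder is δ n = hi - ρ n.
module ClosedForm (b c M c₀ hi W : ℕ) .{{_ : NonZero b}} .{{_ : NonZero c}} .{{_ : NonZero (c * b)}} .{{_ : NonZero M}}
  (M≡2cb : M ≡ 2 * (c * b))
  (2c₀≡  : 2 * c₀ ≡ c * b + (1 + b + c))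
  (hits≡1-base : ∀ {n} → n < c → hits c b c n ≡ 1ℤ)
  (P-base₀ : over 1 b c one (c * b) ≡ over 1 b c one 0 +ℤ ℤ.+ c₀)
  (P-base : ∀ {n} → n < c * b → over 1 b c one n ≡ ℤ.+ (numerator b c hi n / M))
  (δ-base : ∀ {n} → n < c * b → numerator b c hi n % M ≤ W)
  (σ+2+W≤35 : 1 + b + c + 2 + W ≤ 35)
  (hi≤35 : hi ≤ 35)
  (W<hi : W < hi)
  where

  -- The closed form of P.

  B P : PowerSeries
  B = 1/1-q^ b ⊛ (1/1-q^ c ⊛ one)
  P = over 1 b c one

  X p δ : ℕ → ℕ
  X = numerator b c hi
  p n = X n / M
  δ n = X n % M

  hits-periodic : ∀ i n → hits c b i (c + n) ≡ hits c b i n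
  hits-periodic zero    n = refl
  hits-periodic (suc i) n = cong₂ _+ℤ_ (hits-periodic i n) (begin
    (1/1-q^ c ⊛ one) (b + (i * b + (c + n)))
      ≡⟨ cong (1/1-q^ c ⊛ one) (swap b (i * b) c n) ⟩
    (1/1-q^ c ⊛ one) (c + m)                                     ≡⟨ 1/1-q^-⊛-step c one m ⟩
    one (c + m) +ℤ (1/1-q^ c ⊛ one) m
      ≡⟨ cong (_+ℤ (1/1-q^ c ⊛ one) m) (one≡0 (ℕ.≤-trans (>-nonZero⁻¹ c) (ℕ.m≤m+n c m))) ⟩
    0ℤ +ℤ (1/1-q^ c ⊛ one) m                                     ≡⟨ ℤ.+-identityˡ _ ⟩
    (1/1-q^ c ⊛ one) m                                           ∎)
    where
    open ≡-Reasoning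
    m = b + (i * b + n)
    swap : ∀ b x c n → b + (x + (c + n)) ≡ c + (b + (x + n))
    swap = ℕ.solve-∀
    one≡0 : ∀ {m} → 0 < m → one m ≡ 0ℤ
    one≡0 (s≤s _) = refl

  -- For coprime b and c, the numbers n + b, ..., n + cb run through all residues modulo c, so
  -- exactly one is a multiple of c. Here one period of n is checked and then propagated.
  hits≡1 : ∀ n → hits c b c n ≡ 1ℤ
  hits≡1 = period-induction c hits≡1-base (λ n → trans (hits-periodic c n))

  B-iterate : ∀ i n → B (i * b + n) ≡ B n +ℤ hits c b i n
  B-iterate zero    n = sym (ℤ.+-identityʳ (B n))
  B-iterate (suc i) n = begin
    B (b + i * b + n)                             ≡⟨ cong B (ℕ.+-assoc b (i * b) n) ⟩
    B (b + (i * b + n))                           ≡⟨ 1/1-q^-⊛-step b C (i * b + n) ⟩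
    C (b + (i * b + n)) +ℤ B (i * b + n)          ≡⟨ cong (C (b + (i * b + n)) +ℤ_) (B-iterate i n) ⟩
    C (b + (i * b + n)) +ℤ (B n +ℤ hits c b i n)
      ≡⟨ rearrange (C (b + (i * b + n))) (B n) (hits c b i n) ⟩
    B n +ℤ hits c b (suc i) n                     ∎
    where
    open ≡-Reasoning
    C = 1/1-q^ c ⊛ one
    rearrange : ∀ x y z → x +ℤ (y +ℤ z) ≡ y +ℤ (z +ℤ x)
    rearrange = solve-∀

  -- P (n + 1) - P n = B (n + 1), and B gains exactly 1 over a period by `hits≡1`. So the gain of P
  -- over a period rises by 1 with each n, starting from `c₀`.
  P-period : ∀ n → P (c * b + n) ≡ P n +ℤ ℤ.+ (n + c₀)
  P-period zero    = trans (cong P (ℕ.+-identityʳ (c * b))) P-base₀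
  P-period (suc n) = begin
    P (c * b + suc n)                                          ≡⟨ cong P (ℕ.+-suc (c * b) n) ⟩
    P (suc (c * b + n))                                        ≡⟨ 1/1-q^-⊛-step 1 B (c * b + n) ⟩
    B (suc (c * b + n)) +ℤ P (c * b + n)
      ≡⟨ cong₂ _+ℤ_ (trans (cong B (sym (ℕ.+-suc (c * b) n))) (B-iterate c (suc n))) (P-period n) ⟩
    B (suc n) +ℤ hits c b c (suc n) +ℤ (P n +ℤ ℤ.+ (n + c₀))
      ≡⟨ cong (λ x → B (suc n) +ℤ x +ℤ (P n +ℤ ℤ.+ (n + c₀))) (hits≡1 (suc n)) ⟩
    B (suc n) +ℤ 1ℤ +ℤ (P n +ℤ ℤ.+ (n + c₀))
      ≡⟨ rearrange (B (suc n)) 1ℤ (P n) (ℤ.+ (n + c₀)) ⟩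
    B (suc n) +ℤ P n +ℤ ℤ.+ (suc n + c₀)
      ≡⟨ cong (_+ℤ ℤ.+ (suc n + c₀)) (1/1-q^-⊛-step 1 B n) ⟨
    P (suc n) +ℤ ℤ.+ (suc n + c₀)                                ∎
    where
    open ≡-Reasoning
    rearrange : ∀ w x y z → w +ℤ x +ℤ (y +ℤ z) ≡ w +ℤ y +ℤ (x +ℤ z)
    rearrange = solve-∀

  X-period : ∀ n → X (c * b + n) ≡ X n + (n + c₀) * M
  X-period n = begin
    X (L + n)                                          ≡⟨ expand L n (1 + b + c) hi ⟩
    X n + (n * (2 * L) + (L + (1 + b + c)) * L)        ≡⟨ cong (λ x → X n + (n * (2 * L) + x * L)) 2c₀≡ ⟨
    X n + (n * (2 * L) + 2 * c₀ * L)                   ≡⟨ collect (X n) n L c₀ ⟩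
    X n + (n + c₀) * (2 * L)                           ≡⟨ cong (λ x → X n + (n + c₀) * x) M≡2cb ⟨
    X n + (n + c₀) * M                                 ∎
    where
    open ≡-Reasoning
    L = c * b
    expand : ∀ L n s h → (L + n) * (L + n) + s * (L + n) + h ≡ n * n + s * n + h + (n * (2 * L) + (L + s) * L)
    expand = ℕ.solve-∀
    collect : ∀ x n L k → x + (n * (2 * L) + 2 * k * L) ≡ x + (n + k) * (2 * L)
    collect = ℕ.solve-∀

  p-period : ∀ n → p (c * b + n) ≡ p n + (n + c₀)
  p-period n = begin
    X (c * b + n) / M             ≡⟨ cong (_/ M) (X-period n) ⟩
    (X n + (n + c₀) * M) / M      ≡⟨ +-distrib-/-∣ʳ (X n) (n∣m*n (n + c₀)) ⟩
    p n + (n + c₀) * M / M        ≡⟨ cong (p n +_) (m*n/n≡m (n + c₀) M) ⟩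
    p n + (n + c₀)                ∎
    where open ≡-Reasoning

  -- Both sides gain n + c₀ over a period, so agreement on the first period suffices.
  P≡p : ∀ n → P n ≡ ℤ.+ p n
  P≡p = period-induction (c * b) P-base λ n Pn≡pn → begin
    P (c * b + n)                 ≡⟨ P-period n ⟩
    P n +ℤ ℤ.+ (n + c₀)           ≡⟨ cong (_+ℤ ℤ.+ (n + c₀)) Pn≡pn ⟩
    ℤ.+ p n +ℤ ℤ.+ (n + c₀)       ≡⟨ ℤ.pos-+ (p n) (n + c₀) ⟨
    ℤ.+ (p n + (n + c₀))          ≡⟨ cong ℤ.+_ (p-period n) ⟨
    ℤ.+ p (c * b + n)             ∎
    where open ≡-Reasoning

  δ≤W : ∀ n → δ n ≤ W
  δ≤W = period-induction (c * b) δ-base λ n δn≤W →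
    ℕ.≤-trans (ℕ.≤-reflexive (trans (cong (_% M) (X-period n)) ([m+kn]%n≡m%n (X n) (n + c₀) M))) δn≤W

  scaled : ∀ n → ℤ.+ M *ℤ ℤ.+ p n ≡ quad (ℤ.+ (1 + b + c)) (ℤ.+ hi) (ℤ.+ n) -ℤ ℤ.+ δ n
  scaled n = begin
    ℤ.+ M *ℤ ℤ.+ p n                           ≡⟨ rearrange (ℤ.+ M) (ℤ.+ p n) (ℤ.+ δ n) ⟩
    ℤ.+ δ n +ℤ ℤ.+ p n *ℤ ℤ.+ M -ℤ ℤ.+ δ n     ≡⟨ cong (_-ℤ ℤ.+ δ n) δ+pM≡quad ⟩
    quad σ (ℤ.+ hi) (ℤ.+ n) -ℤ ℤ.+ δ n         ∎
    where
    open ≡-Reasoning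
    σ = ℤ.+ (1 + b + c)
    rearrange : ∀ x y z → x *ℤ y ≡ z +ℤ y *ℤ x -ℤ z
    rearrange = solve-∀
    δ+pM≡quad : ℤ.+ δ n +ℤ ℤ.+ p n *ℤ ℤ.+ M ≡ quad σ (ℤ.+ hi) (ℤ.+ n)
    δ+pM≡quad = begin
      ℤ.+ δ n +ℤ ℤ.+ p n *ℤ ℤ.+ M                 ≡⟨ cong (ℤ.+ δ n +ℤ_) (ℤ.pos-* (p n) M) ⟨
      ℤ.+ δ n +ℤ ℤ.+ (p n * M)                    ≡⟨ ℤ.pos-+ (δ n) (p n * M) ⟨
      ℤ.+ (δ n + p n * M)                         ≡⟨ cong ℤ.+_ (m≡m%n+[m/n]*n (X n) M) ⟨
      ℤ.+ (n * n + (1 + b + c) * n + hi)          ≡⟨ ℤ.pos-+ (n * n + (1 + b + c) * n) hi ⟩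
      ℤ.+ (n * n + (1 + b + c) * n) +ℤ ℤ.+ hi
        ≡⟨ cong (_+ℤ ℤ.+ hi) (ℤ.pos-+ (n * n) ((1 + b + c) * n)) ⟩
      ℤ.+ (n * n) +ℤ ℤ.+ ((1 + b + c) * n) +ℤ ℤ.+ hi
        ≡⟨ cong₂ (λ x y → x +ℤ y +ℤ ℤ.+ hi) (ℤ.pos-* n n) (ℤ.pos-* (1 + b + c) n) ⟩
      quad σ (ℤ.+ hi) (ℤ.+ n)                     ∎

  -- Values of `TP` in terms of the offset.

  t : ℕ → ℕ → ℤ
  t k m = TP 1 b c k (pent k + m)

  -- The next exponent is `pent k` + 3k + 2, so only the first term of the alternating sum reaches
  -- this degree.
  t-last : ∀ k m → m < 3 * k + 2 → t k m ≡ P m -ℤ (q^ (2 * k + 1) ⊛ P) m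
  t-last k m m<3k+2 = trans (TP-recurrence 1 b c k m) (trans
    (cong (P m -ℤ (q^ (2 * k + 1) ⊛ P) m -ℤ_) (TP-vanishes-below 1 b c (suc k) (pent k + m)
      (subst (pent k + m <_) (sym (pent-suc k)) (ℕ.+-monoʳ-< (pent k) m<3k+2))))
    (ℤ.+-identityʳ _))

  t-suc : ∀ k r → t k (3 * k + 2 + r) ≡ P (3 * k + 2 + r) -ℤ (q^ (2 * k + 1) ⊛ P) (3 * k + 2 + r) -ℤ t (suc k) r
  t-suc k r = trans (TP-recurrence 1 b c k (3 * k + 2 + r))
    (cong (λ n → P (3 * k + 2 + r) -ℤ (q^ (2 * k + 1) ⊛ P) (3 * k + 2 + r) -ℤ TP 1 b c (suc k) n)
      (trans (sym (ℕ.+-assoc (pent k) (3 * k + 2) r)) (cong (_+ r) (sym (pent-suc k)))))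

  t-low : ∀ k m → m < 2 * k + 1 → t k m ≡ ℤ.+ p m
  t-low k m m<2k+1 = begin
    t k m
      ≡⟨ t-last k m (ℕ.<-trans m<2k+1 (ℕ.+-mono-≤-< (ℕ.*-monoˡ-≤ k {2} {3} (s≤s (s≤s z≤n))) ℕ.≤-refl)) ⟩
    P m -ℤ (q^ (2 * k + 1) ⊛ P) m         ≡⟨ cong₂ _-ℤ_ (P≡p m) (q^-⊛-> (2 * k + 1) m P m<2k+1) ⟩
    ℤ.+ p m +ℤ 0ℤ                         ≡⟨ ℤ.+-identityʳ _ ⟩
    ℤ.+ p m                               ∎
    where open ≡-Reasoning

  t-mid : ∀ k r → r ≤ k → t k (2 * k + 1 + r) ≡ ℤ.+ p (2 * k + 1 + r) -ℤ ℤ.+ p r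
  t-mid k r r≤k = trans
    (t-last k (2 * k + 1 + r) (ℕ.≤-trans (ℕ.+-monoʳ-< (2 * k + 1) (s≤s r≤k)) (ℕ.≤-reflexive (split k))))
    (cong₂ _-ℤ_ (P≡p (2 * k + 1 + r)) (trans (q^-⊛-shift (2 * k + 1) r P) (P≡p r)))
    where
    split : ∀ k → 2 * k + 1 + suc k ≡ 3 * k + 2
    split = ℕ.solve-∀

  t-high : ∀ k r → t k (3 * k + 2 + r) ≡ ℤ.+ p (3 * k + 2 + r) -ℤ ℤ.+ p (suc (k + r)) -ℤ t (suc k) r
  t-high k r = trans (t-suc k r) (cong₂ (λ x y → x -ℤ y -ℤ t (suc k) r) (P≡p (3 * k + 2 + r))
    (trans (cong (q^ (2 * k + 1) ⊛ P) (split k r)) (trans (q^-⊛-shift (2 * k + 1) (suc (k + r)) P) (P≡p (suc (k + r))))))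
    where
    split : ∀ k r → 3 * k + 2 + r ≡ 2 * k + 1 + suc (k + r)
    split = ℕ.solve-∀

  -- Approximation by the leading term.

  private
    σ : ℤ
    σ = ℤ.+ (1 + b + c)

  0≤35-δ : ∀ n → 0ℤ ≤ℤ ℤ.+ 35 -ℤ ℤ.+ δ n
  0≤35-δ n = 0≤difference (ℕ.≤-trans (δ≤W n) (ℕ.≤-trans (ℕ.m≤n+m W (1 + b + c + 2)) σ+2+W≤35))

  scaled-at : ∀ n {x} → ℤ.+ n ≡ x → ℤ.+ M *ℤ ℤ.+ p n ≡ quad σ (ℤ.+ hi) x -ℤ ℤ.+ δ n
  scaled-at n refl = scaled n

  scaled-mid : ∀ k r → r ≤ k → ℤ.+ M *ℤ t k (2 * k + 1 + r) ≡
    quad σ (ℤ.+ hi) (ℤ.+ 2 *ℤ ℤ.+ k +ℤ 1ℤ +ℤ ℤ.+ r) -ℤ ℤ.+ δ (2 * k + 1 + r) -ℤ (quad σ (ℤ.+ hi) (ℤ.+ r) -ℤ ℤ.+ δ r)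
  scaled-mid k r r≤k = *-distribˡ-−-via (ℤ.+ M) (ℤ.+ p (2 * k + 1 + r)) (ℤ.+ p r) (t-mid k r r≤k)
    (scaled-at (2 * k + 1 + r) (pos-linear 2 k 1 r)) (scaled r)

  scaled-high : ∀ k r → ℤ.+ M *ℤ t k (3 * k + 2 + r) ≡
    quad σ (ℤ.+ hi) (ℤ.+ 3 *ℤ ℤ.+ k +ℤ ℤ.+ 2 +ℤ ℤ.+ r) -ℤ ℤ.+ δ (3 * k + 2 + r)
      -ℤ (quad σ (ℤ.+ hi) (1ℤ +ℤ (ℤ.+ k +ℤ ℤ.+ r)) -ℤ ℤ.+ δ (suc (k + r))) -ℤ ℤ.+ M *ℤ t (suc k) r
  scaled-high k r = *-distribˡ-−-via (ℤ.+ M) (ℤ.+ p m -ℤ ℤ.+ p n) (t (suc k) r) (t-high k r)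
    (*-distribˡ-−-via (ℤ.+ M) (ℤ.+ p m) (ℤ.+ p n) refl (scaled-at m (pos-linear 3 k 2 r))
      (scaled-at n (cong (1ℤ +ℤ_) (ℤ.pos-+ k r)))) refl
    where
    m = 3 * k + 2 + r
    n = suc (k + r)

  -- The 3k + 2 offsets with J = k, split by whether P at s - 2k - 1 contributes.
  data Last (k : ℕ) : ℕ → Set where
    low : ∀ {s} → s < 2 * k + 1 → Last k s
    mid : ∀ {r} → r ≤ k → Last k (2 * k + 1 + r)

  last : ∀ k s → s < 3 * k + 2 → Last k s
  last k s s<3k+2 with s ℕ.<? 2 * k + 1
  ... | yes s<2k+1 = low s<2k+1
  ... | no  s≮2k+1 = subst (Last k) (ℕ.m+[n∸m]≡n (ℕ.≮⇒≥ s≮2k+1)) (mid (s≤s⁻¹ (ℕ.+-cancelˡ-< (2 * k + 1) _ _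
    (subst₂ _<_ (sym (ℕ.m+[n∸m]≡n (ℕ.≮⇒≥ s≮2k+1))) (split k) s<3k+2))))
    where
    split : ∀ k → 3 * k + 2 ≡ 2 * k + 1 + suc k
    split = ℕ.solve-∀

  t-near-last : ∀ {k s} → Last k s → Near σ (ℤ.+ W) 0ℤ (ℤ.+ k) (ℤ.+ s) (ℤ.+ M *ℤ t k s)
  t-near-last {k} {s} (low s<2k+1) = near-resp refl (trans (cong (ℤ.+ M *ℤ_) (t-low k s s<2k+1)) (scaled s))
    (low-near {σ} {ℤ.+ W} {ℤ.+ hi} {ℤ.+ k} {ℤ.+ s} {ℤ.+ δ s} 0≤pos 0≤pos 0≤pos 0≤pos 0≤pos
      (subst (λ x → 0ℤ ≤ℤ x -ℤ ℤ.+ s) (ℤ.pos-* 2 k) (0≤difference (s≤s⁻¹ (subst (s <_) (ℕ.+-comm (2 * k) 1) s<2k+1))))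
      (0≤difference hi≤35) (0≤35-δ s))
  t-near-last {k} (mid {r} r≤k) = near-resp (pos-linear 2 k 1 r) (scaled-mid k r r≤k)
    (mid-near {σ} {ℤ.+ W} {ℤ.+ hi} {ℤ.+ k} {ℤ.+ r} {ℤ.+ δ (2 * k + 1 + r)} {ℤ.+ δ r} 0≤pos 0≤pos 0≤pos 0≤pos 0≤pos
      (0≤difference r≤k) (0≤difference σ+2+W≤35) (0≤difference (δ≤W r)) (0≤35-δ (2 * k + 1 + r)))

  t-near-suc : ∀ d k r → Near σ (ℤ.+ W) (ℤ.+ d) (ℤ.+ suc k) (ℤ.+ r) (ℤ.+ M *ℤ t (suc k) r) →
    Near σ (ℤ.+ W) (ℤ.+ suc d) (ℤ.+ k) (ℤ.+ (3 * k + 2 + r)) (ℤ.+ M *ℤ t k (3 * k + 2 + r))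
  t-near-suc d k r near-r = near-resp (pos-linear 3 k 2 r) (scaled-high k r)
    (step-near {σ} {ℤ.+ W} {ℤ.+ hi} {ℤ.+ d} {ℤ.+ k} {ℤ.+ r} {ℤ.+ δ (3 * k + 2 + r)} {ℤ.+ δ (suc (k + r))} {ℤ.+ M *ℤ t (suc k) r}
      0≤pos 0≤pos (0≤difference (δ≤W (3 * k + 2 + r))) (0≤difference (δ≤W (suc (k + r)))) near-r)

  t-near : ∀ d k s → s < 3 * (k + d) + 2 →
    Near σ (ℤ.+ W) (ℤ.+ d) (ℤ.+ k) (ℤ.+ descend d k s) (ℤ.+ M *ℤ t k (descend d k s))
  t-near zero    k s s<3k+2 = t-near-last (last k s (subst (λ j → s < 3 * j + 2) (ℕ.+-identityʳ k) s<3k+2))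
  t-near (suc d) k s s<3J+2 = subst (λ m → Near σ (ℤ.+ W) (ℤ.+ suc d) (ℤ.+ k) (ℤ.+ m) (ℤ.+ M *ℤ t k m))
    (descend-suc d k s)
    (t-near-suc d k (descend d (suc k) s) (t-near d (suc k) s (subst (λ j → s < 3 * j + 2) (ℕ.+-suc k d) s<3J+2)))

  -- Positivity far out, and evaluation of the finite region.

  M*-cancel-pos : ∀ {i} → 0ℤ <ℤ ℤ.+ M *ℤ i → 0ℤ <ℤ i
  M*-cancel-pos {i} 0<M*i = ℤ.*-cancelˡ-<-nonNeg (ℤ.+ M) (subst (_<ℤ ℤ.+ M *ℤ i) (sym (ℤ.*-zeroʳ (ℤ.+ M))) 0<M*i)

  t-positive : ∀ {k d} → Large k d → ∀ s → s < 3 * (k + d) + 2 → 0ℤ <ℤ t k (descend d k s)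
  t-positive {k} {d} large s s<3J+2 = M*-cancel-pos (0<main {σ} {ℤ.+ W} k d (descend d k s) s _
    (2*descend d k s) (0≤difference σ+2+W≤35) (0<excess large s) (t-near d k s s<3J+2))

  -- If the quotient were 0, `X n` would equal its remainder, giving hi ≤ X n = δ n ≤ W < hi.
  p-positive : ∀ n → 0 < p n
  p-positive n with p n in pn≡
  ... | suc _ = ℕ.0<1+n
  ... | zero  = contradiction W<hi (ℕ.≤⇒≯ (ℕ.≤-trans (ℕ.m≤n+m hi (n * n + (1 + b + c) * n)) (ℕ.≤-trans
    (ℕ.≤-reflexive (trans (m≡m%n+[m/n]*n (X n) M) (trans (cong (λ x → δ n + x * M) pn≡) (ℕ.+-identityʳ (δ n))))) (δ≤W n))))

  t-last-positive : ∀ {k s} f → k ≡ 4 + f → Last k s → 0ℤ <ℤ t k s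
  t-last-positive {k} {s} f _    (low s<2k+1)  = subst (0ℤ <ℤ_) (sym (t-low k s s<2k+1)) (+<+ (p-positive s))
  t-last-positive         f refl (mid {r} r≤k) = M*-cancel-pos (subst (0ℤ <ℤ_) (sym (scaled-mid (4 + f) r r≤k))
    (0<mid {σ} {ℤ.+ hi} {ℤ.+ f} {ℤ.+ r} {ℤ.+ δ (2 * (4 + f) + 1 + r)} {ℤ.+ δ r} 0≤pos 0≤pos 0≤pos 0≤pos (0≤35-δ (2 * (4 + f) + 1 + r))))

  -- The recurrence run on the closed form `p`, so that the finite region can be computed without
  -- nested convolutions. The value at fuel 0 is a dummy: `eval-correct` requires m < fuel.
  eval : (fuel k m : ℕ) → ℤ
  eval zero       k m = 0ℤ
  eval (suc fuel) k m =
    ℤ.+ p m -ℤ drop (2 * k + 1) (λ r → ℤ.+ p r) m -ℤ drop (3 * k + 2) (eval fuel (suc k)) m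

  -- Agreement for r < m is enough because the shift 3k + 2 is positive; this lets `eval-correct`
  -- recurse with one unit of fuel less.
  TP-suc-drop : ∀ k m (f : ℕ → ℤ) → (∀ r → r < m → t (suc k) r ≡ f r) →
    TP 1 b c (suc k) (pent k + m) ≡ drop (3 * k + 2) f m
  TP-suc-drop k m f t≡f = drop-elim (3 * k + 2) f m
    (λ m<e → TP-vanishes-below 1 b c (suc k) (pent k + m)
      (subst (pent k + m <_) (sym (pent-suc k)) (ℕ.+-monoʳ-< (pent k) m<e)))
    (λ e≤m → trans (cong (TP 1 b c (suc k)) (reindex e≤m))
      (t≡f (m ∸ (3 * k + 2)) (ℕ.∸-monoʳ-< (ℕ.<-≤-trans ℕ.0<1+n (ℕ.m≤n+m 2 (3 * k))) e≤m)))
    where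
    reindex : 3 * k + 2 ≤ m → pent k + m ≡ pent (suc k) + (m ∸ (3 * k + 2))
    reindex e≤m = trans (cong (pent k +_) (sym (ℕ.m+[n∸m]≡n e≤m)))
      (trans (sym (ℕ.+-assoc (pent k) (3 * k + 2) _)) (cong (_+ (m ∸ (3 * k + 2))) (sym (pent-suc k))))

  eval-correct : ∀ fuel k m → m < fuel → t k m ≡ eval fuel k m
  eval-correct (suc fuel) k m (s≤s m≤fuel) = trans (TP-recurrence 1 b c k m)
    (cong₂ _-ℤ_ (cong₂ _-ℤ_ (P≡p m) q^-⊛-P)
      (TP-suc-drop k m (eval fuel (suc k)) (λ r r<m → eval-correct fuel (suc k) r (ℕ.<-≤-trans r<m m≤fuel))))
    where
    q^-⊛-P : (q^ (2 * k + 1) ⊛ P) m ≡ drop (2 * k + 1) (λ r → ℤ.+ p r) m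
    q^-⊛-P = drop-elim (2 * k + 1) (λ r → ℤ.+ p r) m
      (q^-⊛-> (2 * k + 1) m P) (λ e≤m → trans (q^-⊛-≤ (2 * k + 1) m P e≤m) (P≡p (m ∸ (2 * k + 1))))

  t-positive-far : ∀ k d₀ m → (∀ e → Large k (d₀ + e)) →
    ∃₂ (λ e s → m ≡ descend (d₀ + e) k s × s < 3 * (k + (d₀ + e)) + 2) → 0ℤ <ℤ t k m
  t-positive-far k d₀ m large (e , s , m≡ , s<) = subst (λ m → 0ℤ <ℤ t k m) (sym m≡) (t-positive (large e) s s<)

  t-positive-by-eval : ∀ k m → 0ℤ <ℤ eval (suc m) k m → 0ℤ <ℤ t k m
  t-positive-by-eval k m = subst (0ℤ <ℤ_) (sym (eval-correct (suc m) k m ℕ.≤-refl))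

  -- Assembling the cases in k.

  module _ (zeros : List ℕ)
    -- At k = 1 the first exponent is 2, so the offset m stands for n = 2 + m. The bounds 34 and 6
    -- are the thresholds of `large₁` and `large₂`; the latter serves both k = 2 and k = 3.
    (small₁ : ∀ {m} → m < descend 34 1 0 → 2 + m ∈ zeros ⊎ 0ℤ <ℤ eval (suc m) 1 m)
    (small₂ : ∀ {m} → m < descend 6 2 0 → 0ℤ <ℤ eval (suc m) 2 m)
    (small₃ : ∀ {m} → m < descend 6 3 0 → 0ℤ <ℤ eval (suc m) 3 m)
    (eval≡0 : All (λ n → eval (suc (n ∸ 2)) 1 (n ∸ 2) ≡ 0ℤ) zeros)
    where

    t-cases : ∀ k m → 1 ≤ k → k ≡ 1 × pent k + m ∈ zeros ⊎ 0ℤ <ℤ t k m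
    t-cases 1 m _ = [ [ (λ 2+m∈zeros → inj₁ (refl , 2+m∈zeros)) , inj₂ ∘ t-positive-by-eval 1 m ]′ ∘ small₁
                    , inj₂ ∘ t-positive-far 1 34 m (large₁ 0) ]′ (descend-split 34 1 m)
    t-cases 2 m _ = inj₂ ([ t-positive-by-eval 2 m ∘ small₂ , t-positive-far 2 6 m (large₂ 0) ]′ (descend-split 6 2 m))
    t-cases 3 m _ = inj₂ ([ t-positive-by-eval 3 m ∘ small₃ , t-positive-far 3 6 m (large₂ 1) ]′ (descend-split 6 3 m))
    -- For k ≥ 4 only J = k lies outside `Large`, and there the single-term formula is positive, so
    -- nothing is evaluated.
    t-cases k@(suc (suc (suc (suc f)))) m _ = inj₂
      ([ (λ m< → t-last-positive {k} {m} f refl (last k m (subst (m <_) (ℕ.+-identityʳ (3 * k + 2)) m<)))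
       , t-positive-far k 1 m (large₄ f) ]′ (descend-split 1 k m))

    TP-cases : ∀ k n → 1 ≤ k → pent k ≤ n → k ≡ 1 × n ∈ zeros ⊎ 0ℤ <ℤ TP 1 b c k n
    TP-cases k n 1≤k g≤n = subst (λ x → k ≡ 1 × x ∈ zeros ⊎ 0ℤ <ℤ TP 1 b c k x) (ℕ.m+[n∸m]≡n g≤n) (t-cases k (n ∸ pent k) 1≤k)

    TP≡0 : ∀ n → 2 ≤ n → n ∈ zeros → TP 1 b c 1 n ≡ 0ℤ
    TP≡0 n 2≤n n∈zeros = trans (cong (TP 1 b c 1) (sym (ℕ.m+[n∸m]≡n 2≤n)))
      (trans (eval-correct (suc (n ∸ 2)) 1 (n ∸ 2) ℕ.≤-refl) (All.lookup eval≡0 n∈zeros))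

    nonnegative-except :
      (∀ {k n} → Exceptional 1 b c k n → k ≡ 1 × n ∈ zeros) →
      (∀ {n} → n ∈ zeros → Exceptional 1 b c 1 n) →
      Nonnegative-except 1 b c
    nonnegative-except ⇒∈zeros ∈zeros⇒ = all-k , λ k n 1<k g≤n → positive k n 1<k (TP-cases k n (ℕ.<⇒≤ 1<k) g≤n)
      where
      zero-at : ∀ {k n} → pent k ≤ n → k ≡ 1 × n ∈ zeros → TP 1 b c k n ≡ 0ℤ
      zero-at g≤n (refl , n∈zeros) = TP≡0 _ g≤n n∈zeros

      0≤TP : ∀ {k n} → pent k ≤ n → k ≡ 1 × n ∈ zeros ⊎ 0ℤ <ℤ TP 1 b c k n → 0ℤ ≤ℤ TP 1 b c k n
      0≤TP g≤n (inj₁ exc)  = ℤ.≤-reflexive (sym (zero-at g≤n exc))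
      0≤TP g≤n (inj₂ 0<TP) = ℤ.<⇒≤ 0<TP

      0<TP : ∀ {k n} → k ≡ 1 × n ∈ zeros ⊎ 0ℤ <ℤ TP 1 b c k n → ¬ Exceptional 1 b c k n → 0ℤ <ℤ TP 1 b c k n
      0<TP (inj₁ (refl , n∈zeros)) ¬exc = contradiction (∈zeros⇒ n∈zeros) ¬exc
      0<TP (inj₂ pos)              _    = pos

      all-k : ∀ k n → 1 ≤ k → pent k ≤ n → _
      all-k k n 1≤k g≤n = 0≤TP g≤n (TP-cases k n 1≤k g≤n) , 0<TP (TP-cases k n 1≤k g≤n) , zero-at g≤n ∘ ⇒∈zeros

      positive : ∀ k n → 1 < k → k ≡ 1 × n ∈ zeros ⊎ 0ℤ <ℤ TP 1 b c k n → 0ℤ <ℤ TP 1 b c k n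
      positive k n 1<k (inj₁ (refl , _)) = contradiction 1<k (ℕ.<-irrefl refl)
      positive k n 1<k (inj₂ pos)        = pos

-- The five triples.

nonnegative-1,2,3 : Nonnegative-except 1 2 3
nonnegative-1,2,3 = nonnegative-except zeros
  -- The regions for k = 1, 2, 3 contain 1853, 93 and 111 offsets; they are decided by evaluation
  -- during type checking.
  (toWitness {a? = ℕ.allUpTo? (λ m → (2 + m ∈? zeros) ⊎-dec (0ℤ ℤ.<? eval (suc m) 1 m)) (descend 34 1 0)} tt)
  (toWitness {a? = ℕ.allUpTo? (λ m → 0ℤ ℤ.<? eval (suc m) 2 m) (descend 6 2 0)} tt)
  (toWitness {a? = ℕ.allUpTo? (λ m → 0ℤ ℤ.<? eval (suc m) 3 m) (descend 6 3 0)} tt)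
  (toWitness {a? = All.all? (λ n → eval (suc (n ∸ 2)) 1 (n ∸ 2) ℤ.≟ 0ℤ) zeros} tt)
  (λ { (exc-1,2,3 n∈zeros) → refl , n∈zeros })
  exc-1,2,3
  where
  zeros = 13 ∷ []
  -- In order: b, c, M = 2bc, c₀ = (bc + 1 + b + c)/2, hi and W. Here hi is the value of ρ at 0,
  -- namely 2bc · P 0.
  open ClosedForm 2 3 12 6 12 7 refl refl
    (toWitness {a? = ℕ.allUpTo? (λ n → hits 3 2 3 n ℤ.≟ 1ℤ) 3} tt)
    refl
    (toWitness {a? = ℕ.allUpTo? (λ n → over 1 2 3 one n ℤ.≟ ℤ.+ (numerator 2 3 12 n / 12)) 6} tt)
    (toWitness {a? = ℕ.allUpTo? (λ n → numerator 2 3 12 n % 12 ℕ.≤? 7) 6} tt)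
    (toWitness {a? = 15 ℕ.≤? 35} tt) (toWitness {a? = 12 ℕ.≤? 35} tt) (toWitness {a? = 7 ℕ.<? 12} tt)

nonnegative-1,2,5 : Nonnegative-except 1 2 5
nonnegative-1,2,5 = nonnegative-except zeros
  (toWitness {a? = ℕ.allUpTo? (λ m → (2 + m ∈? zeros) ⊎-dec (0ℤ ℤ.<? eval (suc m) 1 m)) (descend 34 1 0)} tt)
  (toWitness {a? = ℕ.allUpTo? (λ m → 0ℤ ℤ.<? eval (suc m) 2 m) (descend 6 2 0)} tt)
  (toWitness {a? = ℕ.allUpTo? (λ m → 0ℤ ℤ.<? eval (suc m) 3 m) (descend 6 3 0)} tt)
  (toWitness {a? = All.all? (λ n → eval (suc (n ∸ 2)) 1 (n ∸ 2) ℤ.≟ 0ℤ) zeros} tt)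
  (λ { (exc-1,2,5 n∈zeros) → refl , n∈zeros })
  exc-1,2,5
  where
  zeros = 11 ∷ 13 ∷ 15 ∷ []
  open ClosedForm 2 5 20 9 20 13 refl refl
    (toWitness {a? = ℕ.allUpTo? (λ n → hits 5 2 5 n ℤ.≟ 1ℤ) 5} tt)
    refl
    (toWitness {a? = ℕ.allUpTo? (λ n → over 1 2 5 one n ℤ.≟ ℤ.+ (numerator 2 5 20 n / 20)) 10} tt)
    (toWitness {a? = ℕ.allUpTo? (λ n → numerator 2 5 20 n % 20 ℕ.≤? 13) 10} tt)
    (toWitness {a? = 23 ℕ.≤? 35} tt) (toWitness {a? = 20 ℕ.≤? 35} tt) (toWitness {a? = 13 ℕ.<? 20} tt)

nonnegative-1,2,7 : Nonnegative-except 1 2 7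
nonnegative-1,2,7 = nonnegative-except zeros
  (toWitness {a? = ℕ.allUpTo? (λ m → (2 + m ∈? zeros) ⊎-dec (0ℤ ℤ.<? eval (suc m) 1 m)) (descend 34 1 0)} tt)
  (toWitness {a? = ℕ.allUpTo? (λ m → 0ℤ ℤ.<? eval (suc m) 2 m) (descend 6 2 0)} tt)
  (toWitness {a? = ℕ.allUpTo? (λ m → 0ℤ ℤ.<? eval (suc m) 3 m) (descend 6 3 0)} tt)
  (toWitness {a? = All.all? (λ n → eval (suc (n ∸ 2)) 1 (n ∸ 2) ℤ.≟ 0ℤ) zeros} tt)
  (λ { (exc-1,2,7 n∈zeros) → refl , n∈zeros })
  exc-1,2,7
  where
  zeros = 7 ∷ 9 ∷ 11 ∷ 13 ∷ 14 ∷ 15 ∷ []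
  -- Here hi exceeds 2bc: ρ is largest at n = 2, where 28 · 2 - 4 - 20 = 32.
  open ClosedForm 2 7 28 12 32 23 refl refl
    (toWitness {a? = ℕ.allUpTo? (λ n → hits 7 2 7 n ℤ.≟ 1ℤ) 7} tt)
    refl
    (toWitness {a? = ℕ.allUpTo? (λ n → over 1 2 7 one n ℤ.≟ ℤ.+ (numerator 2 7 32 n / 28)) 14} tt)
    (toWitness {a? = ℕ.allUpTo? (λ n → numerator 2 7 32 n % 28 ℕ.≤? 23) 14} tt)
    -- The tight case of σ + 2 + W ≤ 35: 10 + 2 + 23.
    (toWitness {a? = 35 ℕ.≤? 35} tt) (toWitness {a? = 32 ℕ.≤? 35} tt) (toWitness {a? = 23 ℕ.<? 32} tt)

nonnegative-1,3,4 : Nonnegative-except 1 3 4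
nonnegative-1,3,4 = nonnegative-except zeros
  (toWitness {a? = ℕ.allUpTo? (λ m → (2 + m ∈? zeros) ⊎-dec (0ℤ ℤ.<? eval (suc m) 1 m)) (descend 34 1 0)} tt)
  (toWitness {a? = ℕ.allUpTo? (λ m → 0ℤ ℤ.<? eval (suc m) 2 m) (descend 6 2 0)} tt)
  (toWitness {a? = ℕ.allUpTo? (λ m → 0ℤ ℤ.<? eval (suc m) 3 m) (descend 6 3 0)} tt)
  (toWitness {a? = All.all? (λ n → eval (suc (n ∸ 2)) 1 (n ∸ 2) ℤ.≟ 0ℤ) zeros} tt)
  (λ { (exc-1,3,4 n∈zeros) → refl , n∈zeros })
  exc-1,3,4
  where
  zeros = 11 ∷ 13 ∷ 14 ∷ 17 ∷ 38 ∷ 41 ∷ []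
  open ClosedForm 3 4 24 10 24 20 refl refl
    (toWitness {a? = ℕ.allUpTo? (λ n → hits 4 3 4 n ℤ.≟ 1ℤ) 4} tt)
    refl
    (toWitness {a? = ℕ.allUpTo? (λ n → over 1 3 4 one n ℤ.≟ ℤ.+ (numerator 3 4 24 n / 24)) 12} tt)
    (toWitness {a? = ℕ.allUpTo? (λ n → numerator 3 4 24 n % 24 ℕ.≤? 20) 12} tt)
    (toWitness {a? = 30 ℕ.≤? 35} tt) (toWitness {a? = 24 ℕ.≤? 35} tt) (toWitness {a? = 20 ℕ.<? 24} tt)

nonnegative-1,3,5 : Nonnegative-except 1 3 5
nonnegative-1,3,5 = nonnegative-except zeros
  (toWitness {a? = ℕ.allUpTo? (λ m → (2 + m ∈? zeros) ⊎-dec (0ℤ ℤ.<? eval (suc m) 1 m)) (descend 34 1 0)} tt)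
  (toWitness {a? = ℕ.allUpTo? (λ m → 0ℤ ℤ.<? eval (suc m) 2 m) (descend 6 2 0)} tt)
  (toWitness {a? = ℕ.allUpTo? (λ m → 0ℤ ℤ.<? eval (suc m) 3 m) (descend 6 3 0)} tt)
  (toWitness {a? = All.all? (λ n → eval (suc (n ∸ 2)) 1 (n ∸ 2) ℤ.≟ 0ℤ) zeros} tt)
  (λ { (exc-1,3,5 n∈zeros) → refl , n∈zeros })
  exc-1,3,5
  where
  zeros = 10 ∷ 11 ∷ 13 ∷ 14 ∷ 16 ∷ 37 ∷ []
  open ClosedForm 3 5 30 12 30 22 refl refl
    (toWitness {a? = ℕ.allUpTo? (λ n → hits 5 3 5 n ℤ.≟ 1ℤ) 5} tt)
    refl
    (toWitness {a? = ℕ.allUpTo? (λ n → over 1 3 5 one n ℤ.≟ ℤ.+ (numerator 3 5 30 n / 30)) 15} tt)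
    (toWitness {a? = ℕ.allUpTo? (λ n → numerator 3 5 30 n % 30 ℕ.≤? 22) 15} tt)
    (toWitness {a? = 33 ℕ.≤? 35} tt) (toWitness {a? = 30 ℕ.≤? 35} tt) (toWitness {a? = 22 ℕ.<? 30} tt)

theorem1p1 : ∀ α β γ → (α , β , γ) ∈ triples →
    (∀ k n → 1 ≤ k → k * (3 * k + 1) / 2 ≤ n →
    (0ℤ ≤ℤ TP α β γ k n)
    × (¬ Exceptional α β γ k n → 0ℤ <ℤ TP α β γ k n)
    × (Exceptional α β γ k n → TP α β γ k n ≡ 0ℤ))
    × (∀ k n → 1 < k → k * (3 * k + 1) / 2 ≤ n → 0ℤ <ℤ TP α β γ k n)
theorem1p1 _ _ _ (here refl)                                 = nonnegative-1,2,3
theorem1p1 _ _ _ (there (here refl))                         = nonnegative-1,2,5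
theorem1p1 _ _ _ (there (there (here refl)))                 = nonnegative-1,2,7
theorem1p1 _ _ _ (there (there (there (here refl))))         = nonnegative-1,3,4
theorem1p1 _ _ _ (there (there (there (there (here refl))))) = nonnegative-1,3,5
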